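{- Let $X$ be a connected weighted graph. Then the subdivision $S(X)$ is nonsingular (i.e. $A(S(X))$ is invertible) if and only if $X$ is unicyclic and its unique cycle $C_p$, with the weights it inherits from $X$, has nonsingular subdivision $S(C_p)$.
   Context: Graphs are simple, undirected, with nonzero real edge weights; $A(\cdot)$ is the weighted adjacency matrix. The subdivision $S(X)$ of a weighted graph $X$ is obtained by replacing each edge $\{u,v\}$ of weight $\omega$ by a new vertex $w$ and two edges $\{u,w\},\{w,v\}$, each of weight $\omega$. -}

module Defs where

open import Level using (0ℓ)
open import Algebra.Bundles using (CommutativeRing)
import Algebra.Definitions.RawMonoid as RawMonoidDefs
open import Data.Bool.Base using (if_then_else_)
open import Data.Fin.Base using (Fin; toℕ; splitAt; _↑ˡ_; _↑ʳ_)
open import Data.Fin.Properties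
  using (any?; toℕ-injective; toℕ-fromℕ<; toℕ<n; splitAt-↑ˡ; splitAt-↑ʳ; splitAt⁻¹-↑ˡ; splitAt⁻¹-↑ʳ;
         ↑ˡ-injective; ↑ʳ-injective)
  renaming (_≟_ to _≟ᶠ_)
open import Data.Nat.Base as ℕ using (ℕ; suc; z≤n; s≤s)
open import Data.Nat.DivMod using (_mod_; _%_; _/_; m≡m%n+[m/n]*n; m%n<n; %-distribˡ-+; m<n⇒m%n≡m)
open import Data.Nat.Divisibility using (divides; ∣⇒≤)
import Data.Nat.Properties as ℕₚ
open import Data.Product.Base using (∃; _×_; _,_; proj₁; proj₂)
open import Data.Product.Properties using (≡-dec)
open import Data.Rational.Base as ℚ using (ℚ; 0ℚ; 1ℚ; ½; ∣_∣)
import Data.Rational.Properties as ℚₚ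
open import Data.Rational.Solver using (module +-*-Solver)
open import Data.Sum.Base using (_⊎_; inj₁; inj₂; [_,_]′)
open import Function.Base using (_∘_)
open import Function.Bundles using (_⇔_)
open import Function.Definitions using (Injective)
open import Relation.Binary.Construct.Closure.ReflexiveTransitive using (Star)
open import Relation.Binary.PropositionalEquality
  using (_≡_; _≢_; refl; sym; trans; cong; cong₂; subst)
open import Relation.Nullary using (Dec; yes; no; ¬_; does)
open import Relation.Nullary.Decidable using (_⊎-dec_)

------------------------------------------------------------------------
-- Real numbers are Cauchy sequences of rationals, equal when their
-- difference tends to 0, and apart when the difference is eventually
-- bounded away from 0.  Apartness is the constructive form of ≠ (x is
-- invertible exactly when x # 0ℝ); classically it is the negation of ≈.

IsCauchy : (ℕ → ℚ) → Set
IsCauchy x = ∀ ε → 0ℚ ℚ.< ε →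
  ∃ λ N → ∀ m n → N ℕ.≤ m → N ℕ.≤ n → ∣ x m ℚ.- x n ∣ ℚ.< ε

IsNull : (ℕ → ℚ) → Set
IsNull x = ∀ ε → 0ℚ ℚ.< ε → ∃ λ N → ∀ n → N ℕ.≤ n → ∣ x n ∣ ℚ.< ε

record ℝ : Set where
  constructor mkℝ
  field
    seq    : ℕ → ℚ
    cauchy : IsCauchy seq

open ℝ public

infix 4 _≈_ _#_

record _≈_ (x y : ℝ) : Set where
  constructor mk≈
  field
    null : IsNull (λ n → seq x n ℚ.- seq y n)

open _≈_ public

_#_ : ℝ → ℝ → Set
x # y = ∃ λ ε → 0ℚ ℚ.< ε ×
  ∃ λ N → ∀ n → N ℕ.≤ n → ε ℚ.≤ ∣ seq x n ℚ.- seq y n ∣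

module _ where
  open +-*-Solver

  -- Double indexing lets the same lemmas serve IsCauchy (m and n free)
  -- and IsNull (n dummy).
  IsNull₂ : (ℕ → ℕ → ℚ) → Set
  IsNull₂ f = ∀ ε → 0ℚ ℚ.< ε →
    ∃ λ N → ∀ m n → N ℕ.≤ m → N ℕ.≤ n → ∣ f m n ∣ ℚ.< ε

  IsBounded₂ : (ℕ → ℕ → ℚ) → Set
  IsBounded₂ f = ∃ λ B → 0ℚ ℚ.< B ×
    ∃ λ N → ∀ m n → N ℕ.≤ m → N ℕ.≤ n → ∣ f m n ∣ ℚ.≤ B

  null⇒null₂ : ∀ {x} → IsNull x → IsNull₂ (λ m _ → x m)
  null⇒null₂ h ε ε>0 = proj₁ (h ε ε>0) , λ m _ N≤m _ → proj₂ (h ε ε>0) m N≤m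

  null₂⇒null : ∀ {x} → IsNull₂ (λ m _ → x m) → IsNull x
  null₂⇒null h ε ε>0 = proj₁ (h ε ε>0) , λ m N≤m → proj₂ (h ε ε>0) m m N≤m N≤m

  null₂-cong : ∀ {f g} → (∀ m n → f m n ≡ g m n) → IsNull₂ f → IsNull₂ g
  null₂-cong f≡g h ε ε>0 = proj₁ (h ε ε>0) , λ m n N≤m N≤n →
    subst (λ t → ∣ t ∣ ℚ.< ε) (f≡g m n) (proj₂ (h ε ε>0) m n N≤m N≤n)

  null₂-0 : IsNull₂ (λ _ _ → 0ℚ)
  null₂-0 ε ε>0 = 0 , λ _ _ _ _ → ε>0

  half-pos : ∀ {ε} → 0ℚ ℚ.< ε → 0ℚ ℚ.< ε ℚ.* ½
  half-pos ε>0 = ℚₚ.*-monoˡ-<-pos ½ ε>0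

  half+half : ∀ ε → ε ℚ.* ½ ℚ.+ ε ℚ.* ½ ≡ ε
  half+half ε = trans (sym (ℚₚ.*-distribˡ-+ ε ½ ½)) (ℚₚ.*-identityʳ ε)

  null₂-+ : ∀ {f g} → IsNull₂ f → IsNull₂ g → IsNull₂ (λ m n → f m n ℚ.+ g m n)
  null₂-+ {f} {g} hf hg ε ε>0 with hf (ε ℚ.* ½) (half-pos ε>0) | hg (ε ℚ.* ½) (half-pos ε>0)
  ... | N , p | M , q = N ℕ.⊔ M , λ m n l₁ l₂ →
    subst (∣ f m n ℚ.+ g m n ∣ ℚ.<_) (half+half ε)
      (ℚₚ.≤-<-trans (ℚₚ.∣p+q∣≤∣p∣+∣q∣ (f m n) (g m n))
        (ℚₚ.+-mono-< (p m n (ℕₚ.m⊔n≤o⇒m≤o N M l₁) (ℕₚ.m⊔n≤o⇒m≤o N M l₂))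
                     (q m n (ℕₚ.m⊔n≤o⇒n≤o N M l₁) (ℕₚ.m⊔n≤o⇒n≤o N M l₂))))

  null₂-neg : ∀ {f} → IsNull₂ f → IsNull₂ (λ m n → ℚ.- f m n)
  null₂-neg {f} h ε ε>0 = proj₁ (h ε ε>0) , λ m n N≤m N≤n →
    subst (ℚ._< ε) (sym (ℚₚ.∣-p∣≡∣p∣ (f m n))) (proj₂ (h ε ε>0) m n N≤m N≤n)

  null₂-* : ∀ {f g} → IsBounded₂ f → IsNull₂ g → IsNull₂ (λ m n → f m n ℚ.* g m n)
  null₂-* {f} {g} (B , B>0 , M , b) hg ε ε>0 = go
    where
    instance
      B-pos = ℚ.positive B>0
      B-nonNeg = ℚₚ.pos⇒nonNeg B
      B-nonZero = ℚₚ.pos⇒nonZero B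
      B⁻¹-pos = ℚₚ.1/pos⇒pos B
    δ = (ℚ.1/ B) ℚ.* ε
    δ>0 : 0ℚ ℚ.< δ
    δ>0 = subst (ℚ._< δ) (ℚₚ.*-zeroʳ (ℚ.1/ B)) (ℚₚ.*-monoʳ-<-pos (ℚ.1/ B) ε>0)
    Bδ≡ε : B ℚ.* δ ≡ ε
    Bδ≡ε = trans (sym (ℚₚ.*-assoc B (ℚ.1/ B) ε))
      (trans (cong (ℚ._* ε) (ℚₚ.*-inverseʳ B)) (ℚₚ.*-identityˡ ε))
    go : ∃ λ N → ∀ m n → N ℕ.≤ m → N ℕ.≤ n → ∣ f m n ℚ.* g m n ∣ ℚ.< ε
    go with hg δ δ>0
    ... | N , q = N ℕ.⊔ M , λ m n l₁ l₂ →
      let instance _ = ℚₚ.∣-∣-nonNeg (g m n)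
          b′ = b m n (ℕₚ.m⊔n≤o⇒n≤o N M l₁) (ℕₚ.m⊔n≤o⇒n≤o N M l₂)
          q′ = q m n (ℕₚ.m⊔n≤o⇒m≤o N M l₁) (ℕₚ.m⊔n≤o⇒m≤o N M l₂)
      in subst (ℚ._< ε) (sym (ℚₚ.∣p*q∣≡∣p∣*∣q∣ (f m n) (g m n)))
           (ℚₚ.≤-<-trans (ℚₚ.*-monoʳ-≤-nonNeg ∣ g m n ∣ b′)
             (subst (B ℚ.* ∣ g m n ∣ ℚ.<_) Bδ≡ε (ℚₚ.*-monoʳ-<-pos B q′)))

  bounded : ∀ (x : ℝ) → IsBounded₂ (λ m _ → seq x m)
  bounded x with cauchy x 1ℚ (ℚₚ.positive⁻¹ 1ℚ)
  ... | N , c = B , B>0 , N , λ m _ N≤m _ →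
    subst (λ t → ∣ t ∣ ℚ.≤ B) (split (seq x m) (seq x N))
      (ℚₚ.≤-trans (ℚₚ.∣p+q∣≤∣p∣+∣q∣ (seq x m ℚ.- seq x N) (seq x N))
        (ℚₚ.+-monoˡ-≤ ∣ seq x N ∣ (ℚₚ.<⇒≤ (c m N N≤m ℕₚ.≤-refl))))
    where
    B = 1ℚ ℚ.+ ∣ seq x N ∣
    B>0 : 0ℚ ℚ.< B
    B>0 = ℚₚ.+-mono-<-≤ (ℚₚ.positive⁻¹ 1ℚ) (ℚₚ.0≤∣p∣ (seq x N))
    split : ∀ a b → (a ℚ.- b) ℚ.+ b ≡ a
    split = solve 2 (λ a b → (a :- b) :+ b := a) refl

  bounded′ : ∀ (x : ℝ) → IsBounded₂ (λ _ n → seq x n)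
  bounded′ x = let B , B>0 , N , b = bounded x in
    B , B>0 , N , λ m n l₁ l₂ → b n m l₂ l₁

  -- Product differences: a b - c d = a (b - d) + d (a - c).
  null₂-*-diff : ∀ (a b c d : ℕ → ℕ → ℚ) → IsBounded₂ a → IsBounded₂ d →
    IsNull₂ (λ m n → a m n ℚ.- c m n) → IsNull₂ (λ m n → b m n ℚ.- d m n) →
    IsNull₂ (λ m n → a m n ℚ.* b m n ℚ.- c m n ℚ.* d m n)
  null₂-*-diff a b c d ba bd hac hbd =
    null₂-cong (λ m n → eq (a m n) (b m n) (c m n) (d m n))
      (null₂-+ (null₂-* ba hbd) (null₂-* bd hac))
    where
    eq : ∀ a b c d → a ℚ.* (b ℚ.- d) ℚ.+ d ℚ.* (a ℚ.- c) ≡ a ℚ.* b ℚ.- c ℚ.* d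
    eq = solve 4 (λ a b c d → a :* (b :- d) :+ d :* (a :- c) := a :* b :- c :* d) refl

  null₂-+-diff : ∀ (a b c d : ℕ → ℕ → ℚ) →
    IsNull₂ (λ m n → a m n ℚ.- c m n) → IsNull₂ (λ m n → b m n ℚ.- d m n) →
    IsNull₂ (λ m n → (a m n ℚ.+ b m n) ℚ.- (c m n ℚ.+ d m n))
  null₂-+-diff a b c d hac hbd =
    null₂-cong (λ m n → eq (a m n) (b m n) (c m n) (d m n)) (null₂-+ hac hbd)
    where
    eq : ∀ a b c d → (a ℚ.- c) ℚ.+ (b ℚ.- d) ≡ (a ℚ.+ b) ℚ.- (c ℚ.+ d)
    eq = solve 4 (λ a b c d → (a :- c) :+ (b :- d) := (a :+ b) :- (c :+ d)) refl

  null₂-neg-diff : ∀ (a c : ℕ → ℕ → ℚ) → IsNull₂ (λ m n → a m n ℚ.- c m n) →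
    IsNull₂ (λ m n → (ℚ.- a m n) ℚ.- (ℚ.- c m n))
  null₂-neg-diff a c h = null₂-cong (λ m n → eq (a m n) (c m n)) (null₂-neg h)
    where
    eq : ∀ a c → ℚ.- (a ℚ.- c) ≡ (ℚ.- a) ℚ.- (ℚ.- c)
    eq = solve 2 (λ a c → :- (a :- c) := (:- a) :- (:- c)) refl

fromℚ : ℚ → ℝ
fromℚ q = mkℝ (λ _ → q) (null₂-cong (λ _ _ → sym (ℚₚ.+-inverseʳ q)) null₂-0)

0ℝ 1ℝ : ℝ
0ℝ = fromℚ 0ℚ
1ℝ = fromℚ 1ℚ

infixl 6 _+_
infixl 7 _*_
infix 8 -_

_+_ _*_ : ℝ → ℝ → ℝ
x + y = mkℝ (λ n → seq x n ℚ.+ seq y n) (null₂-+-diff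
  (λ m _ → seq x m) (λ m _ → seq y m) (λ _ n → seq x n) (λ _ n → seq y n)
  (cauchy x) (cauchy y))
x * y = mkℝ (λ n → seq x n ℚ.* seq y n)
  (null₂-*-diff
    (λ m _ → seq x m) (λ m _ → seq y m) (λ _ n → seq x n) (λ _ n → seq y n)
    (bounded x) (bounded′ y) (cauchy x) (cauchy y))

-_ : ℝ → ℝ
- x = mkℝ (λ n → ℚ.- seq x n) (null₂-neg-diff (λ m _ → seq x m) (λ _ n → seq x n) (cauchy x))

≡⇒≈ : ∀ {x y} → (∀ n → seq x n ≡ seq y n) → x ≈ y
≡⇒≈ {x} {y} eq = mk≈ (null₂⇒null
  (null₂-cong (λ m _ → sym (trans (cong (ℚ._- seq y m) (eq m)) (ℚₚ.+-inverseʳ (seq y m)))) null₂-0))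

≈-sym : ∀ {x y} → x ≈ y → y ≈ x
≈-sym {x} {y} (mk≈ h) = mk≈ (null₂⇒null
  (null₂-cong (λ m _ → eq (seq x m) (seq y m)) (null₂-neg (null⇒null₂ h))))
  where
  open +-*-Solver
  eq : ∀ a b → ℚ.- (a ℚ.- b) ≡ b ℚ.- a
  eq = solve 2 (λ a b → :- (a :- b) := b :- a) refl

≈-trans : ∀ {x y z} → x ≈ y → y ≈ z → x ≈ z
≈-trans {x} {y} {z} (mk≈ h) (mk≈ k) = mk≈ (null₂⇒null
  (null₂-cong (λ m _ → eq (seq x m) (seq y m) (seq z m)) (null₂-+ (null⇒null₂ h) (null⇒null₂ k))))
  where
  open +-*-Solver
  eq : ∀ a b c → (a ℚ.- b) ℚ.+ (b ℚ.- c) ≡ a ℚ.- c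
  eq = solve 3 (λ a b c → (a :- b) :+ (b :- c) := a :- c) refl

ℝ-commutativeRing : CommutativeRing 0ℓ 0ℓ
ℝ-commutativeRing = record
  { Carrier = ℝ
  ; _≈_ = _≈_
  ; _+_ = _+_
  ; _*_ = _*_
  ; -_ = -_
  ; 0# = 0ℝ
  ; 1# = 1ℝ
  ; isCommutativeRing = record
    { isRing = record
      { +-isAbelianGroup = record
        { isGroup = record
          { isMonoid = record
            { isSemigroup = record
              { isMagma = record
                { isEquivalence = record
                  { refl = ≡⇒≈ (λ _ → refl) ; sym = ≈-sym ; trans = ≈-trans }
                ; ∙-cong = λ {x} {y} {u} {v} (mk≈ h) (mk≈ k) → mk≈ (null₂⇒null
                    (null₂-+-diff
                      (λ m _ → seq x m) (λ m _ → seq u m) (λ m _ → seq y m) (λ m _ → seq v m)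
                      (null⇒null₂ h) (null⇒null₂ k)))
                }
              ; assoc = λ x y z → ≡⇒≈ λ n → ℚₚ.+-assoc (seq x n) (seq y n) (seq z n)
              }
            ; identity = (λ x → ≡⇒≈ λ n → ℚₚ.+-identityˡ (seq x n))
                       , (λ x → ≡⇒≈ λ n → ℚₚ.+-identityʳ (seq x n))
            }
          ; inverse = (λ x → ≡⇒≈ λ n → ℚₚ.+-inverseˡ (seq x n))
                    , (λ x → ≡⇒≈ λ n → ℚₚ.+-inverseʳ (seq x n))
          ; ⁻¹-cong = λ {x} {y} (mk≈ h) → mk≈ (null₂⇒null (null₂-neg-diff
              (λ m _ → seq x m) (λ m _ → seq y m) (null⇒null₂ h)))
          }
        ; comm = λ x y → ≡⇒≈ λ n → ℚₚ.+-comm (seq x n) (seq y n)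
        }
      ; *-cong = λ {x} {y} {u} {v} (mk≈ h) (mk≈ k) → mk≈ (null₂⇒null
          (null₂-*-diff
            (λ m _ → seq x m) (λ m _ → seq u m) (λ m _ → seq y m) (λ m _ → seq v m)
            (bounded x) (bounded v) (null⇒null₂ h) (null⇒null₂ k)))
      ; *-assoc = λ x y z → ≡⇒≈ λ n → ℚₚ.*-assoc (seq x n) (seq y n) (seq z n)
      ; *-identity = (λ x → ≡⇒≈ λ n → ℚₚ.*-identityˡ (seq x n))
                   , (λ x → ≡⇒≈ λ n → ℚₚ.*-identityʳ (seq x n))
      ; distrib = (λ x y z → ≡⇒≈ λ n → ℚₚ.*-distribˡ-+ (seq x n) (seq y n) (seq z n))
                , (λ x y z → ≡⇒≈ λ n → ℚₚ.*-distribʳ-+ (seq x n) (seq y n) (seq z n))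
      }
    ; *-comm = λ x y → ≡⇒≈ λ n → ℚₚ.*-comm (seq x n) (seq y n)
    }
  }

------------------------------------------------------------------------

open RawMonoidDefs (CommutativeRing.+-rawMonoid ℝ-commutativeRing) public using (sum)

Matrix : ℕ → Set
Matrix n = Fin n → Fin n → ℝ

infix 4 _≈ᴹ_
infixl 7 _*ᴹ_

_≈ᴹ_ : ∀ {n} → Matrix n → Matrix n → Set
M ≈ᴹ N = ∀ i j → M i j ≈ N i j

_*ᴹ_ : ∀ {n} → Matrix n → Matrix n → Matrix n
(M *ᴹ N) i j = sum (λ k → M i k * N k j)

1ᴹ : ∀ {n} → Matrix n
1ᴹ i j = if does (i ≟ᶠ j) then 1ℝ else 0ℝ

Invertible : ∀ {n} → Matrix n → Set
Invertible M = ∃ λ N → (M *ᴹ N ≈ᴹ 1ᴹ) × (N *ᴹ M ≈ᴹ 1ᴹ)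

------------------------------------------------------------------------

-- Edges are unordered: the order in which ends lists the two endpoints has
-- no meaning, and Joins is symmetric in u and v.
record WeightedGraph : Set where
  field
    order size : ℕ
  Vertex = Fin order
  Edge   = Fin size
  field
    ends : Edge → Vertex × Vertex
  Joins : Edge → Vertex → Vertex → Set
  Joins e u v = ends e ≡ (u , v) ⊎ ends e ≡ (v , u)
  field
    loopless  : ∀ {e v} → ¬ Joins e v v
    simple    : ∀ {e f u v} → Joins e u v → Joins f u v → e ≡ f
    weight    : Edge → ℝ
    weight#0  : ∀ e → weight e # 0ℝ

  joins? : ∀ u v e → Dec (Joins e u v)
  joins? u v e = ≡-dec _≟ᶠ_ _≟ᶠ_ (ends e) (u , v) ⊎-dec ≡-dec _≟ᶠ_ _≟ᶠ_ (ends e) (v , u)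

  Adjacent : Vertex → Vertex → Set
  Adjacent u v = ∃ λ e → Joins e u v

  adjacent? : ∀ u v → Dec (Adjacent u v)
  adjacent? u v = any? (joins? u v)

A : (X : WeightedGraph) → Matrix (WeightedGraph.order X)
A X u v with WeightedGraph.adjacent? X u v
... | yes (e , _) = WeightedGraph.weight X e
... | no _        = 0ℝ

Nonsingular : WeightedGraph → Set
Nonsingular X = Invertible (A X)

Connected : WeightedGraph → Set
Connected X = ℕ.NonZero order × (∀ u v → Star Adjacent u v)
  where open WeightedGraph X

------------------------------------------------------------------------

-- Vertices of S X: the vertices v ↑ˡ size of X, and a vertex order ↑ʳ e for
-- each edge e of X.  Edges of S X: the two halves e ↑ˡ size, size ↑ʳ e of
-- each edge e.
module Subdivision (X : WeightedGraph) where
  open WeightedGraph X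

  halfEnds : Edge ⊎ Edge → Fin (order ℕ.+ size) × Fin (order ℕ.+ size)
  halfEnds (inj₁ e) = (proj₁ (ends e) ↑ˡ size) , (order ↑ʳ e)
  halfEnds (inj₂ e) = (order ↑ʳ e) , (proj₂ (ends e) ↑ˡ size)

  subEnds : Fin (size ℕ.+ size) → Fin (order ℕ.+ size) × Fin (order ℕ.+ size)
  subEnds e = halfEnds (splitAt size e)

  subWeight : Fin (size ℕ.+ size) → ℝ
  subWeight e = [ weight , weight ]′ (splitAt size e)

  ↑ˡ≢↑ʳ : ∀ {v : Vertex} {e : Edge} → v ↑ˡ size ≢ order ↑ʳ e
  ↑ˡ≢↑ʳ {v} {e} eq with trans (sym (splitAt-↑ˡ order v size)) (trans (cong (splitAt order) eq) (splitAt-↑ʳ order size e))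
  ... | ()

  ends-distinct : ∀ {e} → proj₁ (ends e) ≢ proj₂ (ends e)
  ends-distinct {e} eq = loopless {e} {proj₁ (ends e)} (inj₁ (cong (proj₁ (ends e) ,_) (sym eq)))

  halfEnds-loopless : ∀ s {v} → halfEnds s ≢ (v , v)
  halfEnds-loopless (inj₁ e) eq = ↑ˡ≢↑ʳ (trans (cong proj₁ eq) (sym (cong proj₂ eq)))
  halfEnds-loopless (inj₂ e) eq = ↑ˡ≢↑ʳ (trans (cong proj₂ eq) (sym (cong proj₁ eq)))

  swap : Fin (order ℕ.+ size) × Fin (order ℕ.+ size) → Fin (order ℕ.+ size) × Fin (order ℕ.+ size)
  swap (a , b) = b , a

  halfEnds-injective : ∀ s t → halfEnds s ≡ halfEnds t → s ≡ t
  halfEnds-injective (inj₁ e) (inj₁ f) eq = cong inj₁ (↑ʳ-injective order e f (cong proj₂ eq))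
  halfEnds-injective (inj₁ e) (inj₂ f) eq with () ← ↑ˡ≢↑ʳ (cong proj₁ eq)
  halfEnds-injective (inj₂ e) (inj₁ f) eq with () ← ↑ˡ≢↑ʳ (sym (cong proj₁ eq))
  halfEnds-injective (inj₂ e) (inj₂ f) eq = cong inj₂ (↑ʳ-injective order e f (cong proj₁ eq))

  halfEnds-unswapped : ∀ s t → halfEnds s ≢ swap (halfEnds t)
  halfEnds-unswapped (inj₁ e) (inj₁ f) eq = ↑ˡ≢↑ʳ (cong proj₁ eq)
  halfEnds-unswapped (inj₂ e) (inj₂ f) eq = ↑ˡ≢↑ʳ (cong proj₂ eq)
  halfEnds-unswapped (inj₁ e) (inj₂ f) eq
    with refl ← ↑ʳ-injective order e f (cong proj₂ eq) =
    ends-distinct (↑ˡ-injective size _ _ (cong proj₁ eq))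
  halfEnds-unswapped (inj₂ e) (inj₁ f) eq
    with refl ← ↑ʳ-injective order e f (cong proj₁ eq) =
    ends-distinct (sym (↑ˡ-injective size _ _ (cong proj₂ eq)))

  splitAt-injective : ∀ e f → splitAt size e ≡ splitAt size f → e ≡ f
  splitAt-injective e f eq with splitAt size {size} e in p | splitAt size {size} f in q
  splitAt-injective e f refl | inj₁ a | inj₁ a = trans (sym (splitAt⁻¹-↑ˡ p)) (splitAt⁻¹-↑ˡ q)
  splitAt-injective e f refl | inj₂ a | inj₂ a = trans (sym (splitAt⁻¹-↑ʳ p)) (splitAt⁻¹-↑ʳ q)

  S : WeightedGraph
  S = record
    { order    = order ℕ.+ size
    ; size     = size ℕ.+ size
    ; ends     = subEnds
    ; loopless = λ {e} → λ where
        (inj₁ p) → halfEnds-loopless (splitAt size e) p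
        (inj₂ p) → halfEnds-loopless (splitAt size e) p
    ; simple   = λ {e} {f} p q → splitAt-injective e f (same (splitAt size e) (splitAt size f) p q)
    ; weight   = subWeight
    ; weight#0 = weight#0′
    }
    where
    same : ∀ s t {u v} → halfEnds s ≡ (u , v) ⊎ halfEnds s ≡ (v , u) →
           halfEnds t ≡ (u , v) ⊎ halfEnds t ≡ (v , u) → s ≡ t
    same s t (inj₁ p) (inj₁ q) = halfEnds-injective s t (trans p (sym q))
    same s t (inj₂ p) (inj₂ q) = halfEnds-injective s t (trans p (sym q))
    same s t (inj₁ p) (inj₂ q) with () ← halfEnds-unswapped s t (trans p (sym (cong swap q)))
    same s t (inj₂ p) (inj₁ q) with () ← halfEnds-unswapped s t (trans p (sym (cong swap q)))
    weight#0′ : ∀ e → subWeight e # 0ℝ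
    weight#0′ e with splitAt size {size} e
    ... | inj₁ a = weight#0 a
    ... | inj₂ a = weight#0 a

open Subdivision public using (S)

------------------------------------------------------------------------

next : ∀ {n} → Fin (suc n) → Fin (suc n)
next {n} i = suc (toℕ i) mod suc n

record Cycle (X : WeightedGraph) : Set where
  open WeightedGraph X
  field
    length-3 : ℕ  -- length minus 3: a cycle has at least three vertices
  length = 3 ℕ.+ length-3
  field
    vertex           : Fin length → Vertex
    vertex-injective : Injective _≡_ _≡_ vertex
    edge             : Fin length → Edge
    edge-joins       : ∀ i → Joins (edge i) (vertex i) (vertex (next i))

  HasVertex : Vertex → Set
  HasVertex v = ∃ λ i → vertex i ≡ v

  HasEdge : Edge → Set
  HasEdge e = ∃ λ i → edge i ≡ e

-- Cycles are identified when they are the same subgraph, so that neither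
-- the starting vertex nor the direction of traversal matters.
SameCycle : ∀ {X} → Cycle X → Cycle X → Set
SameCycle C D = (∀ v → Cycle.HasVertex C v ⇔ Cycle.HasVertex D v)
              × (∀ e → Cycle.HasEdge C e ⇔ Cycle.HasEdge D e)

record Unicyclic (X : WeightedGraph) : Set where
  field
    connected : Connected X
    cycle     : Cycle X
    unique    : ∀ C → SameCycle C cycle

module _ where
  shift-fixed : ∀ {n} d (i : Fin (suc n)) → 0 ℕ.< d → d ℕ.< suc n → (d ℕ.+ toℕ i) % suc n ≢ toℕ i
  shift-fixed {n} (suc d) i _ d<n eq = ℕₚ.<⇒≱ d<n (∣⇒≤ (divides q d≡))
    where
    q = (suc d ℕ.+ toℕ i) / suc n
    d≡ : suc d ≡ q ℕ.* suc n
    d≡ = ℕₚ.+-cancelˡ-≡ (toℕ i) (suc d) (q ℕ.* suc n)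
      (trans (ℕₚ.+-comm (toℕ i) (suc d))
        (trans (m≡m%n+[m/n]*n (suc d ℕ.+ toℕ i) (suc n)) (cong (ℕ._+ q ℕ.* suc n) eq)))

  toℕ-next : ∀ {n} (i : Fin (suc n)) → toℕ (next i) ≡ suc (toℕ i) % suc n
  toℕ-next {n} i = toℕ-fromℕ< (m%n<n (suc (toℕ i)) (suc n))

  next≢ : ∀ {n} (i : Fin (2 ℕ.+ n)) → next i ≢ i
  next≢ i eq = shift-fixed 1 i (s≤s z≤n) (s≤s (s≤s z≤n)) (trans (sym (toℕ-next i)) (cong toℕ eq))

  next-next≢ : ∀ {n} (i : Fin (3 ℕ.+ n)) → next (next i) ≢ i
  next-next≢ {n} i eq = shift-fixed 2 i (s≤s z≤n) (s≤s (s≤s (s≤s z≤n)))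
    (trans (sym two) (trans (sym (toℕ-next (next i))) (cong toℕ eq)))
    where
    p = 3 ℕ.+ n
    two : suc (toℕ (next i)) % p ≡ (2 ℕ.+ toℕ i) % p
    two = trans (cong (λ t → suc t % p) (toℕ-next i))
      (trans (cong (λ t → (t ℕ.+ suc (toℕ i) % p) % p) (sym (m<n⇒m%n≡m {n = p} (s≤s (s≤s (z≤n {suc n}))))))
        (sym (%-distribˡ-+ 1 (suc (toℕ i)) p)))

cycleGraph : ∀ {X} → Cycle X → WeightedGraph
cycleGraph {X} C = record
  { order    = length
  ; size     = length
  ; ends     = λ i → i , next i
  ; loopless = λ where
      (inj₁ p) → next≢ _ (trans (cong proj₂ p) (sym (cong proj₁ p)))
      (inj₂ p) → next≢ _ (trans (cong proj₂ p) (sym (cong proj₁ p)))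
  ; simple   = λ where
      (inj₁ p) (inj₁ q) → cong proj₁ (trans p (sym q))
      (inj₂ p) (inj₂ q) → cong proj₁ (trans p (sym q))
      (inj₁ p) (inj₂ q) → cross p q
      (inj₂ p) (inj₁ q) → cross p q
  ; weight   = λ i → weight (edge i)
  ; weight#0 = λ i → weight#0 (edge i)
  }
  where
  open Cycle C
  open WeightedGraph X using (weight; weight#0)
  cross : ∀ {i j u v : Fin length} → (i , next i) ≡ (u , v) → (j , next j) ≡ (v , u) → i ≡ j
  cross {i} refl q with () ← next-next≢ i (trans (cong next (sym (cong proj₁ q))) (cong proj₂ q))

{-# OPTIONS --safe #-}
-- In the bipartition "vertices, edges" of S(X) the adjacency matrix is
-- [0 B; Bᵀ 0] with B the weighted incidence matrix, so S(X) is nonsingular iff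
-- B has a two-sided inverse.  Comparing the traces of BC = 1 and CB = 1 then
-- gives |V| = |E|, and X is not bipartite since the signs of a 2-colouring
-- lie in the left kernel of B.
--
-- Fix a spanning tree T.  If |V| = |E| exactly one edge f, the chord, lies
-- outside T, and X is nonbipartite iff f is odd: its ends have the same colour
-- in the 2-colouring of T.  Conversely, an odd chord makes B invertible: a
-- left inverse is found by solving z(u) + z(v) = g(uv) along T and adding
-- the multiple of the colouring that corrects f; a right inverse by telescoping
-- along T, which leaves only the basis vector at the root, obtained from f.
--
-- A chord is unique iff X is unicyclic: a cycle crosses every cut an even number
-- of times, and the cut obtained from T by removing a tree edge e contains no
-- other edge except perhaps f, so membership of e in a cycle is determined by
-- that of f.  The same parity count shows that an odd chord makes the cycle
-- nonbipartite; hence X and its cycle satisfy the criterion simultaneously.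
module Submission where

open import Defs
open import Data.Product.Base using (Σ)
open import Function.Bundles using (_⇔_)

open import Algebra.Bundles using (CommutativeMonoid; CommutativeRing)
import Algebra.Properties.CommutativeMonoid.Sum as MonoidSum
import Algebra.Properties.Ring as RingProperties
import Algebra.Properties.Semiring.Sum as SemiringSum
import Algebra.Solver.Ring.NaturalCoefficients.Default as SemiringSolver
open import Data.Bool.Base using (Bool; true; false; not; _xor_; _∧_; if_then_else_)
open import Data.Bool.Properties
  using (xor-same; xor-comm; xor-assoc; xor-identityʳ; xor-∧-commutativeRing;
         ∧-zeroʳ; ∧-identityʳ; ∧-conicalʳ; ¬-not)
  renaming (_≟_ to _≟ᵇ_)
open import Data.Fin.Base
  using (Fin; zero; suc; toℕ; fromℕ; fromℕ<; inject₁; splitAt; _↑ˡ_; _↑ʳ_)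
open import Data.Fin.Properties
  using (_≟_; any?; toℕ-injective; toℕ-fromℕ; toℕ-inject₁; toℕ<n; suc-injective; injective⇒≤;
         punchOut-injective; splitAt-↑ˡ; splitAt-↑ʳ; splitAt⁻¹-↑ˡ; splitAt⁻¹-↑ʳ;
         ↑ˡ-injective; ↑ʳ-injective)
open import Data.Fin.Relation.Unary.Top using (view; ‵fromℕ; ‵inj₁)
open import Data.Nat.Base as ℕ using (ℕ; zero; suc; z≤n; s≤s; _≤_; _%_; _⊔_)
open import Data.Nat.DivMod using (m<n⇒m%n≡m; n%n≡0)
import Data.Nat.Properties as ℕₚ
open import Data.Product.Base using (∃; _×_; _,_; proj₁; proj₂)
open import Data.Rational.Base as ℚ using (ℚ; 0ℚ; 1ℚ; ½; ∣_∣)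
import Data.Rational.Properties as ℚₚ
open import Data.Rational.Solver using (module +-*-Solver)
open import Data.Sum.Base using (_⊎_; inj₁; inj₂; swap)
open import Function.Base using (_∘_; _$_)
open import Function.Bundles using (mk⇔; module Equivalence)
open import Function.Definitions using (Injective)
open import Level using (0ℓ)
open import Relation.Binary.Construct.Closure.ReflexiveTransitive as Star using (Star; _◅_; _◅◅_; reverse)
open import Relation.Binary.PropositionalEquality
  using (_≡_; _≢_; refl; sym; trans; cong; cong₂; subst; subst₂; module ≡-Reasoning)
import Relation.Binary.Reasoning.Setoid as SetoidReasoning
open import Relation.Nullary using (Dec; yes; no; ¬_; does; contradiction)
open import Relation.Nullary.Decidable using (_×-dec_; ¬?; dec-true; dec-false; decidable-stable)

-- Real numbers

-- Junk value 0 at 0.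
inv : ℚ → ℚ
inv q with q ℚₚ.≟ 0ℚ
... | yes _   = 0ℚ
... | no q≢0 = ℚ.1/_ q {{ℚ.≢-nonZero q≢0}}

*-inv : ∀ {q} → q ≢ 0ℚ → q ℚ.* inv q ≡ 1ℚ
*-inv {q} q≢0 with q ℚₚ.≟ 0ℚ
... | yes q≡0 = contradiction q≡0 q≢0
... | no q≢0  = ℚₚ.*-inverseʳ q {{ℚ.≢-nonZero q≢0}}

∣q∣≥ε⇒q≢0 : ∀ {ε q} → 0ℚ ℚ.< ε → ε ℚ.≤ ∣ q ∣ → q ≢ 0ℚ
∣q∣≥ε⇒q≢0 ε>0 ε≤∣q∣ refl = ℚₚ.<-irrefl refl (ℚₚ.<-≤-trans ε>0 ε≤∣q∣)

-- After multiplication by `ε` this reads ε |1/q| ≤ |q| |1/q| = 1 = ε (1/ε).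
∣inv∣≤ : ∀ {ε q} → 0ℚ ℚ.< ε → ε ℚ.≤ ∣ q ∣ → ∣ inv q ∣ ℚ.≤ inv ε
∣inv∣≤ {ε} {q} ε>0 ε≤∣q∣ = ℚₚ.*-cancelˡ-≤-pos ε (subst (ε ℚ.* ∣ inv q ∣ ℚ.≤_) ∣q∣∣inv∣≡
    (ℚₚ.*-monoʳ-≤-nonNeg ∣ inv q ∣ ε≤∣q∣))
  where
  instance
    ε-pos = ℚ.positive ε>0
    _ = ℚₚ.∣-∣-nonNeg (inv q)
  ε≢0 : ε ≢ 0ℚ
  ε≢0 ε≡0 = ℚₚ.<-irrefl (sym ε≡0) ε>0
  ∣q∣∣inv∣≡ : ∣ q ∣ ℚ.* ∣ inv q ∣ ≡ ε ℚ.* inv ε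
  ∣q∣∣inv∣≡ = trans (sym (ℚₚ.∣p*q∣≡∣p∣*∣q∣ q (inv q)))
    (trans (cong ∣_∣ (*-inv (∣q∣≥ε⇒q≢0 ε>0 ε≤∣q∣))) (sym (*-inv ε≢0)))

-- 1/a − 1/b = (1/a)(1/b)(b − a).
#0⇒invertible : ∀ {x} → x # 0ℝ → ∃ λ y → x * y ≈ 1ℝ
#0⇒invertible {x} (ε , ε>0 , N , away) = y , mk≈ (null₂⇒null
    (eventually-null {λ m → seq x m ℚ.* z m ℚ.- 1ℚ} λ m N≤m →
      trans (cong (ℚ._- 1ℚ) (*-inv (x≢0 m N≤m))) (ℚₚ.+-inverseʳ 1ℚ)))
  where
  open +-*-Solver
  z : ℕ → ℚ
  z n = inv (seq x n)
  away′ : ∀ n → N ℕ.≤ n → ε ℚ.≤ ∣ seq x n ∣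
  away′ n N≤n = subst (λ t → ε ℚ.≤ ∣ t ∣) (ℚₚ.+-identityʳ (seq x n)) (away n N≤n)
  x≢0 : ∀ n → N ℕ.≤ n → seq x n ≢ 0ℚ
  x≢0 n N≤n = ∣q∣≥ε⇒q≢0 ε>0 (away′ n N≤n)
  eventually-null : ∀ {f} → (∀ m → N ℕ.≤ m → f m ≡ 0ℚ) → IsNull₂ (λ m _ → f m)
  eventually-null f≡0 η η>0 = N , λ m _ N≤m _ → subst (λ t → ∣ t ∣ ℚ.< η) (sym (f≡0 m N≤m)) η>0
  1/ε>0 : 0ℚ ℚ.< inv ε
  1/ε>0 = ℚₚ.*-cancelˡ-<-nonNeg ε {{ℚₚ.pos⇒nonNeg ε {{ℚ.positive ε>0}}}}
    (subst₂ ℚ._<_ (sym (ℚₚ.*-zeroʳ ε)) (sym (*-inv (λ ε≡0 → ℚₚ.<-irrefl (sym ε≡0) ε>0)))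
      (ℚₚ.positive⁻¹ 1ℚ))
  instance
    1/ε-pos = ℚ.positive 1/ε>0
    1/ε-nonNeg = ℚₚ.pos⇒nonNeg (inv ε)
  z-bound : IsBounded₂ (λ m n → z m ℚ.* z n)
  z-bound = inv ε ℚ.* inv ε ,
    subst (ℚ._< inv ε ℚ.* inv ε) (ℚₚ.*-zeroʳ (inv ε)) (ℚₚ.*-monoʳ-<-pos (inv ε) 1/ε>0) ,
    N , λ m n N≤m N≤n →
      subst (ℚ._≤ inv ε ℚ.* inv ε) (sym (ℚₚ.∣p*q∣≡∣p∣*∣q∣ (z m) (z n)))
        (ℚₚ.≤-trans
          (ℚₚ.*-monoʳ-≤-nonNeg ∣ z n ∣ {{ℚₚ.∣-∣-nonNeg (z n)}} (∣inv∣≤ ε>0 (away′ m N≤m)))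
          (ℚₚ.*-monoˡ-≤-nonNeg (inv ε) (∣inv∣≤ ε>0 (away′ n N≤n))))
  diff : ∀ {a b} → a ≢ 0ℚ → b ≢ 0ℚ → (inv a ℚ.* inv b) ℚ.* (ℚ.- (a ℚ.- b)) ≡ inv a ℚ.- inv b
  diff {a} {b} a≢0 b≢0 = trans
    (solve 4 (λ a b c d → (c :* d) :* (:- (a :- b)) := c :* (b :* d) :- d :* (a :* c)) refl a b (inv a) (inv b))
    (cong₂ ℚ._-_ (one (inv a) (*-inv b≢0)) (one (inv b) (*-inv a≢0)))
    where
    one : ∀ c {t} → t ≡ 1ℚ → c ℚ.* t ≡ c
    one c refl = ℚₚ.*-identityʳ c
  y : ℝ
  y = mkℝ z λ η η>0 →
    let M , small = null₂-* z-bound (null₂-neg (cauchy x)) η η>0 in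
    -- Before index `N` a term of `z` may be the junk value 0, so the modulus must also lie beyond
    -- `N`.
    M ⊔ N , λ m n l₁ l₂ → subst (λ t → ∣ t ∣ ℚ.< η)
      (diff (x≢0 m (ℕₚ.m⊔n≤o⇒n≤o M N l₁)) (x≢0 n (ℕₚ.m⊔n≤o⇒n≤o M N l₂)))
      (small m n (ℕₚ.m⊔n≤o⇒m≤o M N l₁) (ℕₚ.m⊔n≤o⇒m≤o M N l₂))

-- Spanning trees and coboundaries

least : {P : ℕ → Set} → (∀ k → Dec (P k)) → ∀ n → P n → ∃ λ k → P k × (∀ j → P j → k ≤ j)
least P? zero    p = zero , p , λ _ _ → z≤n
least P? (suc n) p with P? zero
... | yes p₀ = zero , p₀ , λ _ _ → z≤n
... | no ¬p₀ with k , q , k-min ← least (P? ∘ suc) n p =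
  suc k , q , λ where
    zero    p₀ → contradiction p₀ ¬p₀
    (suc j) pⱼ → s≤s (k-min j pⱼ)

-- The parent and the parent edge of the root have no meaning.
record SpanningTree (X : WeightedGraph) : Set where
  open WeightedGraph X
  field
    root             : Vertex
    parent           : Vertex → Vertex
    parentEdge       : Vertex → Edge
    depth            : Vertex → ℕ
    depth-parent     : ∀ {v} → v ≢ root → depth v ≡ suc (depth (parent v))
    parentEdge-joins : ∀ {v} → v ≢ root → Joins (parentEdge v) v (parent v)

module BreadthFirst (X : WeightedGraph) (connected : Connected X) (e₀ : WeightedGraph.Edge X) where
  open WeightedGraph X

  root : Vertex
  root = proj₁ (ends e₀)

  Reach : ℕ → Vertex → Set
  Reach zero    v = v ≡ root
  Reach (suc k) v = ∃ λ u → Adjacent v u × Reach k u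

  reach? : ∀ v k → Dec (Reach k v)
  reach? v zero    = v ≟ root
  reach? v (suc k) = any? λ u → adjacent? v u ×-dec reach? u k

  reachable : ∀ {v} → Star Adjacent v root → ∃ λ k → Reach k v
  reachable Star.ε           = zero , refl
  reachable (v~u ◅ u⇝r) with k , r ← reachable u⇝r = suc k , _ , v~u , r

  shortest : ∀ v → ∃ λ k → Reach k v × (∀ j → Reach j v → k ≤ j)
  shortest v = let k , r = reachable (proj₂ connected v root) in least (reach? v) k r

  depth : Vertex → ℕ
  depth v = proj₁ (shortest v)

  -- The first step of a shortest walk to the root lowers the distance by exactly one: the rest of
  -- the walk bounds the distance of `u` from above, and a shorter walk from `u` would give a
  -- shorter one from `v`. The pair is produced for every `v` so that parents form a total function;
  -- at the root `e₀` serves as the default edge.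
  descend : ∀ v → Σ (Vertex × Edge) λ (u , e) →
    v ≢ root → depth v ≡ suc (depth u) × Joins e v u
  descend v with shortest v
  ... | zero  , v≡r , _ = (v , e₀) , λ v≢r → contradiction v≡r v≢r
  ... | suc k , (u , (e , joins) , r) , k-min = (u , e) , λ _ →
    ℕₚ.≤-antisym
      (k-min _ (u , (e , joins) , proj₁ (proj₂ (shortest u))))
      (s≤s (proj₂ (proj₂ (shortest u)) k r)) ,
    joins

  spanningTree : SpanningTree X
  spanningTree = record
    { root             = root
    ; parent           = λ v → proj₁ (proj₁ (descend v))
    ; parentEdge       = λ v → proj₂ (proj₁ (descend v))
    ; depth            = depth
    ; depth-parent     = λ {v} v≢r → proj₁ (proj₂ (descend v) v≢r)
    ; parentEdge-joins = λ {v} v≢r → proj₂ (proj₂ (descend v) v≢r)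
    }

open BreadthFirst using (spanningTree)

-- The coboundary over the field with two elements: it marks the edges that cross the cut between
-- the two classes of `c`.
δ : ∀ X → let open WeightedGraph X in (Vertex → Bool) → Edge → Bool
δ X c e = c (proj₁ (ends e)) xor c (proj₂ (ends e))
  where open WeightedGraph X

δ-joins : ∀ X → let open WeightedGraph X in
  (c : Vertex → Bool) → ∀ {e u v} → Joins e u v → δ X c e ≡ c u xor c v
δ-joins X c (inj₁ eq) rewrite eq = refl
δ-joins X c {u = u} {v} (inj₂ eq) rewrite eq = xor-comm (c v) (c u)

Bipartite : WeightedGraph → Set
Bipartite X = ∃ λ c → ∀ e → δ X c e ≡ true

joins-ends : ∀ X → let open WeightedGraph X in ∀ {e u v x y} →
  Joins e u v → Joins e x y → (u ≡ x × v ≡ y) ⊎ (u ≡ y × v ≡ x)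
joins-ends X (inj₁ p) (inj₁ q) with refl ← trans (sym p) q = inj₁ (refl , refl)
joins-ends X (inj₁ p) (inj₂ q) with refl ← trans (sym p) q = inj₂ (refl , refl)
joins-ends X (inj₂ p) (inj₁ q) with refl ← trans (sym p) q = inj₂ (refl , refl)
joins-ends X (inj₂ p) (inj₂ q) with refl ← trans (sym p) q = inj₁ (refl , refl)

module Tree {X : WeightedGraph} (T : SpanningTree X) where
  open WeightedGraph X
  open SpanningTree T public

  TreeEdge : Edge → Set
  TreeEdge e = ∃ λ v → v ≢ root × parentEdge v ≡ e

  treeEdge? : ∀ e → Dec (TreeEdge e)
  treeEdge? e = any? λ v → ¬? (v ≟ root) ×-dec (parentEdge v ≟ e)

  -- Two different vertices with the same parent edge would be each other's parents, and the depth
  -- of `v` would exceed itself by 2.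
  parentEdge-injective : ∀ {v w} → v ≢ root → w ≢ root → parentEdge v ≡ parentEdge w → v ≡ w
  parentEdge-injective {v} {w} v≢r w≢r eq
    with joins-ends X (parentEdge-joins v≢r)
           (subst (λ e → Joins e w (parent w)) (sym eq) (parentEdge-joins w≢r))
  ... | inj₁ (v≡w , _)   = v≡w
  ... | inj₂ (v≡pw , pv≡w) = contradiction depths (ℕₚ.m≢1+n+m (depth v) {1})
    where
    depths : depth v ≡ suc (suc (depth v))
    depths = trans (depth-parent v≢r) (cong suc
      (trans (cong depth pv≡w) (trans (depth-parent w≢r) (cong (suc ∘ depth) (sym v≡pw)))))

  tree-induction : (P : Vertex → Set) → P root →
    (∀ {v} → v ≢ root → P (parent v) → P v) → ∀ v → P v
  tree-induction P base step v = go (depth v) v refl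
    where
    go : ∀ k v → depth v ≡ k → P v
    go k v dv≡k with v ≟ root
    ... | yes refl = base
    go zero    v dv≡0 | no v≢r with () ← trans (sym dv≡0) (depth-parent v≢r)
    go (suc k) v dv≡k | no v≢r =
      step v≢r (go k (parent v) (ℕₚ.suc-injective (trans (sym (depth-parent v≢r)) dv≡k)))

  -- The depth is the fuel, and it drops by one from a vertex to its parent. The depth of the root
  -- is not fixed to be 0, so `rec root` need not be `a`; the recurrence `rec-parent` is the
  -- specification.
  module Recursion {A : Set} (a : A) (step : Vertex → A → A) where
    go : ℕ → Vertex → A
    go zero    v = a
    go (suc k) v = step v (go k (parent v))

    rec : Vertex → A
    rec v = go (depth v) v

    rec-parent : ∀ {v} → v ≢ root → rec v ≡ step v (rec (parent v))
    rec-parent {v} v≢r = cong (λ k → go k v) (depth-parent v≢r)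

  -- A tree has no cycles, so every labelling of its edges is a coboundary: up to a constant, the
  -- potential of a vertex is the sum of the labels on its path to the root.
  potential-on-tree : (g : Edge → Bool) → ∃ λ c → ∀ {e} → TreeEdge e → δ X c e ≡ g e
  potential-on-tree g = rec , λ where
      (v , v≢r , refl) → trans (δ-joins X rec (parentEdge-joins v≢r))
        (trans (cong (_xor rec (parent v)) (rec-parent v≢r)) (cancel (g (parentEdge v)) (rec (parent v))))
    where
    open Recursion false (λ v b → g (parentEdge v) xor b)
    cancel : ∀ a b → (a xor b) xor b ≡ a
    cancel a b = trans (xor-assoc a b b) (trans (cong (a xor_) (xor-same b)) (xor-comm a false))

-- Cycles

module SingleTerm (M : CommutativeMonoid 0ℓ 0ℓ) where
  open CommutativeMonoid M using (Carrier; ∙-cong; ∙-congˡ; identityˡ; identityʳ)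
    renaming (_≈_ to _≋_; ε to 0#; trans to ≋-trans)
  open MonoidSum M using (sum-cong-≋; sum-replicate-zero) renaming (sum to ∑)

  sum-zero : ∀ {n} (t : Fin n → Carrier) → (∀ i → t i ≋ 0#) → ∑ t ≋ 0#
  sum-zero {n} t t≋0 = ≋-trans (sum-cong-≋ t≋0) (sum-replicate-zero n)

  sum-single : ∀ {n} (t : Fin n → Carrier) i → (∀ j → j ≢ i → t j ≋ 0#) → ∑ t ≋ t i
  sum-single {suc n} t zero    t≋0 = ≋-trans
    (∙-congˡ (sum-zero (t ∘ suc) λ j → t≋0 (suc j) λ ())) (identityʳ (t zero))
  sum-single {suc n} t (suc i) t≋0 = ≋-trans
    (∙-cong (t≋0 zero λ ()) (sum-single (t ∘ suc) i λ j j≢i → t≋0 (suc j) (j≢i ∘ suc-injective)))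
    (identityˡ (t (suc i)))

open MonoidSum (CommutativeRing.+-commutativeMonoid xor-∧-commutativeRing)
  using ()
  renaming (sum to parity; ∑-distrib-+ to parity-xor; sum-init-last to parity-init-last;
            sum-cong-≗ to parity-cong)
open SingleTerm (CommutativeRing.+-commutativeMonoid xor-∧-commutativeRing)
  using () renaming (sum-zero to parity-zero; sum-single to parity-single)

next-inject₁ : ∀ {n} (j : Fin n) → next (inject₁ j) ≡ suc j
next-inject₁ {n} j = toℕ-injective (trans (toℕ-next (inject₁ j))
  (trans (cong (λ t → suc t % suc n) (toℕ-inject₁ j)) (m<n⇒m%n≡m (s≤s (toℕ<n j)))))

next-fromℕ : ∀ n → next (fromℕ n) ≡ zero
next-fromℕ n = toℕ-injective (trans (toℕ-next (fromℕ n))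
  (trans (cong (λ t → suc t % suc n) (toℕ-fromℕ n)) (n%n≡0 (suc n))))

-- `next` is a cyclic shift: the last term of the shifted family is the first term of the original
-- one, and the remaining terms agree.
parity-next : ∀ {n} (c : Fin (suc n) → Bool) → parity (c ∘ next) ≡ parity c
parity-next {n} c = begin
  parity (c ∘ next)                                  ≡⟨ parity-init-last (c ∘ next) ⟩
  parity (c ∘ next ∘ inject₁) xor c (next (fromℕ n)) ≡⟨ cong₂ _xor_
    (parity-cong (cong c ∘ next-inject₁)) (cong c (next-fromℕ n)) ⟩
  parity (c ∘ suc) xor c zero                        ≡⟨ xor-comm (parity (c ∘ suc)) (c zero) ⟩
  parity c                                           ∎
  where open ≡-Reasoning

-- Going once around, every label enters two terms, so a labelling changes an even number of times.
parity-boundary : ∀ {n} (c : Fin (suc n) → Bool) → parity (λ i → c i xor c (next i)) ≡ false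
parity-boundary c = trans (parity-xor c (c ∘ next))
  (trans (cong (parity c xor_) (parity-next c)) (xor-same (parity c)))

xor-false⇒≡ : ∀ a b → a xor b ≡ false → a ≡ b
xor-false⇒≡ false b     eq = sym eq
xor-false⇒≡ true  true  eq = refl

parity-∧ : ∀ {n} b (t : Fin n → Bool) → parity (λ i → b ∧ t i) ≡ b ∧ parity t
parity-∧ {n} false t = parity-zero {n} (λ _ → false) λ _ → refl
parity-∧ true  t = refl

module CycleParity {X : WeightedGraph} (C : Cycle X) where
  open WeightedGraph X
  open Cycle C

  -- An edge traversed at two positions in opposite directions would give `next (next j) ≡ j`, which
  -- is impossible with at least three vertices.
  edge-injective : Injective _≡_ _≡_ edge
  edge-injective {i} {j} eq
    with joins-ends X (edge-joins i) (subst (λ e → Joins e _ _) (sym eq) (edge-joins j))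
  ... | inj₁ (p , _) = vertex-injective p
  ... | inj₂ (p , q) = contradiction
    (trans (cong next (sym (vertex-injective p))) (vertex-injective q)) (next-next≢ j)

  hasEdge? : ∀ e → Dec (HasEdge e)
  hasEdge? e = any? λ i → edge i ≟ e

  -- The edge set of the cycle as a vector over the field with two elements. As no edge is repeated,
  -- this parity is membership, but in this form it is additive and can be compared with cuts.
  multiplicity : Edge → Bool
  multiplicity e = parity λ i → does (edge i ≟ e)

  hasEdge⇒ : ∀ {e} → HasEdge e → multiplicity e ≡ true
  hasEdge⇒ {e} (i , refl) = trans
    (parity-single (λ j → does (edge j ≟ e)) i λ j j≢i → dec-false (edge j ≟ e) (j≢i ∘ edge-injective))
    (dec-true (edge i ≟ e) refl)

  hasEdge⇐ : ∀ {e} → multiplicity e ≡ true → HasEdge e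
  hasEdge⇐ {e} eq = decidable-stable (hasEdge? e) λ ∄ → contradiction
    (trans (sym eq) (parity-zero (λ i → does (edge i ≟ e)) λ i → dec-false (edge i ≟ e) λ p → ∄ (i , p))) λ ()

  -- Cycles are orthogonal to cuts over the field with two elements.
  parity-δ : ∀ c → parity (λ i → δ X c (edge i)) ≡ false
  parity-δ c = trans (parity-cong λ i → δ-joins X c (edge-joins i)) (parity-boundary (c ∘ vertex))

  -- By hypothesis the cut of `c` is the edge `a` together with, if `b` holds, the edge `f`. The
  -- cycle meets it in an even number of edges, so its use of `a` is dictated by its use of `f`.
  multiplicity-cut : ∀ {c a b f} → (∀ e → δ X c e ≡ does (e ≟ a) xor (b ∧ does (e ≟ f))) →
    multiplicity a ≡ b ∧ multiplicity f
  multiplicity-cut {c} {a} {b} {f} δc = xor-false⇒≡ _ _ $ begin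
    multiplicity a xor (b ∧ multiplicity f) ≡⟨ cong (multiplicity a xor_) (parity-∧ b (λ i → does (edge i ≟ f))) ⟨
    multiplicity a xor parity (λ i → b ∧ does (edge i ≟ f))
      ≡⟨ parity-xor (λ i → does (edge i ≟ a)) (λ i → b ∧ does (edge i ≟ f)) ⟨
    parity (λ i → does (edge i ≟ a) xor (b ∧ does (edge i ≟ f))) ≡⟨ parity-cong (λ i → δc (edge i)) ⟨
    parity (λ i → δ X c (edge i)) ≡⟨ parity-δ c ⟩
    false ∎
    where open ≡-Reasoning

  cycleGraph-connected : Connected (cycleGraph C)
  cycleGraph-connected = _ , λ i j → reverse symmetric (from-0 i) ◅◅ from-0 j
    where
    module G = WeightedGraph (cycleGraph C)
    symmetric : ∀ {i j} → G.Adjacent i j → G.Adjacent j i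
    symmetric (e , joins) = e , swap joins
    go : ∀ k j → toℕ j ≡ k → Star G.Adjacent zero j
    go zero    zero    _  = Star.ε
    go (suc k) (suc j) eq = go k (inject₁ j) (trans (toℕ-inject₁ j) (ℕₚ.suc-injective eq)) ◅◅
      (inject₁ j , inj₁ (cong (inject₁ j ,_) (next-inject₁ j))) ◅ Star.ε
    from-0 : ∀ j → Star G.Adjacent zero j
    from-0 j = go (toℕ j) j refl

  bipartite-cycleGraph : Bipartite X → Bipartite (cycleGraph C)
  bipartite-cycleGraph (c , δc) = c ∘ vertex , λ i → trans (sym (δ-joins X c (edge-joins i))) (δc (edge i))

-- A cycle is determined by its edges: each vertex is an end of a cycle edge, and wherever the other
-- cycle traverses that edge it visits both of its ends.
sameCycle : ∀ {X} (C D : Cycle X) →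
  (∀ e → CycleParity.multiplicity C e ≡ CycleParity.multiplicity D e) → SameCycle C D
sameCycle {X} C D eq =
  (λ v → mk⇔ (vertices C D (edges C D eq)) (vertices D C (edges D C (sym ∘ eq)))) ,
  (λ e → mk⇔ (edges C D eq) (edges D C (sym ∘ eq)))
  where
  edges : ∀ C D → (∀ e → CycleParity.multiplicity C e ≡ CycleParity.multiplicity D e) →
    ∀ {e} → Cycle.HasEdge C e → Cycle.HasEdge D e
  edges C D eq {e} h = CycleParity.hasEdge⇐ D (trans (sym (eq e)) (CycleParity.hasEdge⇒ C h))
  vertices : ∀ C D → (∀ {e} → Cycle.HasEdge C e → Cycle.HasEdge D e) →
    ∀ {v} → Cycle.HasVertex C v → Cycle.HasVertex D v
  vertices C D h (i , refl) with j , eq ← h (i , refl)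
    with joins-ends X (Cycle.edge-joins D j) (subst (λ e → WeightedGraph.Joins X e _ _) (sym eq) (Cycle.edge-joins C i))
  ... | inj₁ (p , _) = j , p
  ... | inj₂ (_ , p) = next j , p

-- Simple paths and the cycles they close

module SimplePath (X : WeightedGraph) (Q : WeightedGraph.Edge X → Set) where
  open WeightedGraph X

  Step : Vertex → Vertex → Set
  Step u v = ∃ λ e → Q e × Joins e u v

  data Path : ℕ → Vertex → Vertex → Set where
    []  : ∀ {v} → Path 0 v v
    _∷_ : ∀ {k u w v} → Step u w → Path k w v → Path (suc k) u v

  vertexAt : ∀ {k u v} → Path k u v → Fin (suc k) → Vertex
  vertexAt {u = u} p       zero    = u
  vertexAt         (_ ∷ p) (suc i) = vertexAt p i

  Simple : ∀ {k u v} → Path k u v → Set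
  Simple p = Injective _≡_ _≡_ (vertexAt p)

  suffix : ∀ {k u v} (p : Path k u v) → Simple p → ∀ i →
    ∃ λ l → Σ (Path l (vertexAt p i) v) Simple
  suffix p       simple zero    = _ , p , simple
  suffix (_ ∷ p) simple (suc i) = suffix p (suc-injective ∘ simple) i

  []-simple : ∀ {v} → Simple ([] {v})
  []-simple {_} {zero} {zero} _ = refl

  ∷-simple : ∀ {k u w v} (s : Step u w) (p : Path k w v) → ¬ (∃ λ i → vertexAt p i ≡ u) →
    Simple p → Simple (s ∷ p)
  ∷-simple s p u∉p p-simple {zero}  {zero}  _  = refl
  ∷-simple s p u∉p p-simple {zero}  {suc j} eq = contradiction (j , sym eq) u∉p
  ∷-simple s p u∉p p-simple {suc i} {zero}  eq = contradiction (i , eq) u∉p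
  ∷-simple s p u∉p p-simple {suc i} {suc j} eq = cong suc (p-simple eq)

  -- If the new first vertex already occurs on the simple path built so far, the part of that path
  -- from the occurrence onwards replaces everything.
  erase-loops : ∀ {u v} → Star Step u v → ∃ λ k → Σ (Path k u v) Simple
  erase-loops Star.ε = 0 , [] , []-simple
  erase-loops {u} (s ◅ ss) with k , p , p-simple ← erase-loops ss
    with any? (λ i → vertexAt p i ≟ u)
  ... | yes (i , refl) = suffix p p-simple i
  ... | no u∉p         = suc k , s ∷ p , ∷-simple s p u∉p p-simple

  -- The edges of the path followed by `f`: one edge leaving each of the `suc k` vertices, as a
  -- cycle requires.
  closedEdge : ∀ {k u v} → Path k u v → Edge → Fin (suc k) → Edge
  closedEdge []            f i       = f
  closedEdge ((e , _) ∷ p) f zero    = e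
  closedEdge (_ ∷ p)       f (suc i) = closedEdge p f i

  closedEdge-joins : ∀ {k u v} (p : Path k u v) f (j : Fin k) →
    Joins (closedEdge p f (inject₁ j)) (vertexAt p (inject₁ j)) (vertexAt p (suc j))
  closedEdge-joins ((_ , _ , joins) ∷ p)  f zero    = joins
  closedEdge-joins (_ ∷ p) f (suc j) = closedEdge-joins p f j

  closedEdge-last : ∀ {k u v} (p : Path k u v) f → closedEdge p f (fromℕ k) ≡ f
  closedEdge-last []      f = refl
  closedEdge-last (_ ∷ p) f = closedEdge-last p f

  vertexAt-last : ∀ {k u v} (p : Path k u v) → vertexAt p (fromℕ k) ≡ v
  vertexAt-last []      = refl
  vertexAt-last (_ ∷ p) = vertexAt-last p

  closedEdge-origin : ∀ {k u v} (p : Path k u v) f i → closedEdge p f i ≡ f ⊎ Q (closedEdge p f i)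
  closedEdge-origin []                f i       = inj₁ refl
  closedEdge-origin ((_ , q , _) ∷ p) f zero    = inj₂ q
  closedEdge-origin (_ ∷ p)           f (suc i) = closedEdge-origin p f i

  -- After loop erasure, a path of length 0 would make `f` a loop, and one of length 1 would make
  -- `f` parallel, hence equal, to an edge in `Q`. Any longer path together with `f` has at least
  -- three vertices and is a cycle.
  closing-cycle : ∀ {f u v} → ¬ Q f → Joins f v u → Star Step u v →
    Σ (Cycle X) λ C → Cycle.HasEdge C f × (∀ e → Cycle.HasEdge C e → e ≡ f ⊎ Q e)
  closing-cycle {f} ¬Qf f-joins path with erase-loops path
  ... | 0 , [] , _ = contradiction f-joins loopless
  ... | 1 , ((e , Qe , e-joins) ∷ []) , _ = contradiction (subst Q (simple (swap e-joins) f-joins) Qe) ¬Qf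
  ... | suc (suc k) , p , p-simple = C , (fromℕ _ , closedEdge-last p f) ,
      λ where _ (i , refl) → closedEdge-origin p f i
    where
    joins-next : ∀ i → Joins (closedEdge p f i) (vertexAt p i) (vertexAt p (next i))
    -- At the last position the edge is `f` and `next` wraps around to the start of the path.
    joins-next i with view i
    ... | ‵fromℕ rewrite closedEdge-last p f | vertexAt-last p | next-fromℕ (suc (suc k)) = f-joins
    ... | ‵inj₁ {i = j} _ rewrite next-inject₁ j = closedEdge-joins p f j
    C : Cycle X
    C = record
      { length-3         = k
      ; vertex           = vertexAt p
      ; vertex-injective = p-simple
      ; edge             = closedEdge p f
      ; edge-joins       = joins-next
      }

-- Pigeonhole: punching out the missed value would embed `Fin (suc n)` in `Fin n`.
no-injection-missing : ∀ {m n} → m ≡ n → (h : Fin m → Fin n) → (∀ {i j} → h i ≡ h j → i ≡ j) →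
  ∀ k → ¬ (∀ i → k ≢ h i)
no-injection-missing {n = suc n} refl h h-injective k misses =
  ℕₚ.1+n≰n (injective⇒≤ λ {i} {j} eq → h-injective (punchOut-injective (misses i) (misses j) eq))

-- Fundamental cycles and odd chords

module Chords {X : WeightedGraph} (T : SpanningTree X) where
  open WeightedGraph X
  open Tree T

  -- Both ends of `f` reach the root through tree edges, so the tree contains a walk between them,
  -- which `f` closes.
  fundamental-cycle : ∀ {f} → ¬ TreeEdge f →
    Σ (Cycle X) λ C → Cycle.HasEdge C f × (∀ e → Cycle.HasEdge C e → e ≡ f ⊎ TreeEdge e)
  fundamental-cycle {f} ¬tree =
    closing-cycle ¬tree (inj₁ refl) (to-root _ ◅◅ reverse symmetric (to-root _))
    where
    open SimplePath X TreeEdge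
    symmetric : ∀ {u v} → Step u v → Step v u
    symmetric (e , tree , joins) = e , tree , swap joins
    to-root : ∀ v → Star Step v root
    to-root = tree-induction (λ v → Star Step v root) Star.ε λ {v} v≢r path →
      (parentEdge v , (v , v≢r , refl) , parentEdge-joins v≢r) ◅ path

  colouring : ∃ λ c → ∀ {e} → TreeEdge e → δ X c e ≡ true
  colouring = potential-on-tree λ _ → true

  -- The graph is the tree plus one edge. Equal colours at the ends of that edge mean that the tree
  -- path between them has even length, so the cycle it closes is odd.
  record OddChord : Set where
    field
      chord        : Edge
      spans        : ∀ e → e ≡ chord ⊎ TreeEdge e
      chord-colour : δ X (proj₁ colouring) chord ≡ false

    chord∉tree : ¬ TreeEdge chord
    chord∉tree tree = contradiction (trans (sym chord-colour) (proj₂ colouring tree)) λ ()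

    -- Labelling only the parent edge of `w` gives a potential that separates the two pieces of the
    -- tree left when this edge is removed; `b` records whether the chord crosses between them. As
    -- `b` is chosen before `C`, it is the same for all cycles.
    cut : ∀ {w} → w ≢ root → ∃ λ b → ∀ (C : Cycle X) →
      CycleParity.multiplicity C (parentEdge w) ≡ b ∧ CycleParity.multiplicity C chord
    cut {w} w≢r with c , δc ← potential-on-tree (λ e → does (e ≟ parentEdge w)) =
      δ X c chord , λ C → CycleParity.multiplicity-cut C {c} (by-cases c δc)
      where
      by-cases : ∀ c → (∀ {e} → TreeEdge e → δ X c e ≡ does (e ≟ parentEdge w)) →
        ∀ e → δ X c e ≡ does (e ≟ parentEdge w) xor (δ X c chord ∧ does (e ≟ chord))
      by-cases c δc e with spans e
      ... | inj₁ refl rewrite dec-false (chord ≟ parentEdge w) (λ eq → chord∉tree (w , w≢r , sym eq))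
                            | dec-true (chord ≟ chord) refl = sym (∧-identityʳ (δ X c chord))
      ... | inj₂ tree rewrite dec-false (e ≟ chord) (λ eq → chord∉tree (subst TreeEdge eq tree))
                            | ∧-zeroʳ (δ X c chord)
                            | xor-identityʳ (does (e ≟ parentEdge w)) = δc tree

    -- The tree alone contains no cycle: if the first edge of `C` is a tree edge, its multiplicity
    -- is true, and `cut` writes it as a conjunction with that of the chord.
    chord∈cycle : ∀ C → CycleParity.multiplicity C chord ≡ true
    chord∈cycle C with spans (Cycle.edge C zero)
    ... | inj₁ eq = CycleParity.hasEdge⇒ C (zero , eq)
    ... | inj₂ (w , w≢r , eq) = ∧-conicalʳ _ _
      (trans (sym (proj₂ (cut w≢r) C)) (CycleParity.hasEdge⇒ C (zero , sym eq)))

    unicyclic : Connected X → Unicyclic X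
    unicyclic connected = record
      { connected = connected
      ; cycle     = D
      ; unique    = λ C → sameCycle C D (agree C)
      }
      where
      D = proj₁ (fundamental-cycle chord∉tree)
      agree : ∀ C e → CycleParity.multiplicity C e ≡ CycleParity.multiplicity D e
      agree C e with spans e
      ... | inj₁ refl = trans (chord∈cycle C) (sym (chord∈cycle D))
      ... | inj₂ (w , w≢r , refl) = trans (proj₂ (cut w≢r) C)
        (trans (cong (proj₁ (cut w≢r) ∧_) (trans (chord∈cycle C) (sym (chord∈cycle D))))
          (sym (proj₂ (cut w≢r) D)))

    -- A 2-colouring of the cycle differs from the restriction of the tree
    -- colouring by a labelling that changes exactly once, at the chord.
    cycleGraph-nonbipartite : ∀ C → ¬ Bipartite (cycleGraph C)
    cycleGraph-nonbipartite C (t , δt) = contradiction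
      (trans (sym (chord∈cycle C)) (trans (parity-cong changes) (parity-boundary q))) λ ()
      where
      open Cycle C
      c = proj₁ colouring
      q : Fin length → Bool
      q i = c (vertex i) xor t i
      -- Since `t` changes at every step of the cycle, `q` changes exactly where the tree colouring
      -- does not.
      rearrange : ∀ a b a′ b′ → b xor b′ ≡ true → (a xor b) xor (a′ xor b′) ≡ not (a xor a′)
      rearrange false false false true  _ = refl
      rearrange false false true  true  _ = refl
      rearrange true  false false true  _ = refl
      rearrange true  false true  true  _ = refl
      rearrange false true  false false _ = refl
      rearrange false true  true  false _ = refl
      rearrange true  true  false false _ = refl
      rearrange true  true  true  false _ = refl
      δ-chord : ∀ e → does (e ≟ chord) ≡ not (δ X c e)
      δ-chord e with spans e
      ... | inj₁ refl = trans (dec-true (chord ≟ chord) refl) (cong not (sym chord-colour))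
      ... | inj₂ tree = trans (dec-false (e ≟ chord) λ eq → chord∉tree (subst TreeEdge eq tree))
        (cong not (sym (proj₂ colouring tree)))
      changes : ∀ i → does (edge i ≟ chord) ≡ q i xor q (next i)
      changes i = trans (δ-chord (edge i)) (trans (cong not (δ-joins X c (edge-joins i)))
        (sym (rearrange (c (vertex i)) (t i) (c (vertex (next i))) (t (next i)) (δt i))))

  -- Otherwise the tree colouring would be a 2-colouring of the whole graph; searching the finitely
  -- many edges makes the argument constructive.
  monochromatic-edge : ¬ Bipartite X → ∃ λ e → δ X (proj₁ colouring) e ≡ false
  monochromatic-edge nonbipartite = decidable-stable (any? λ e → δ X (proj₁ colouring) e ≟ᵇ false) λ ∄ →
    nonbipartite (proj₁ colouring , λ e → ¬-not λ eq → ∄ (e , eq))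

  monochromatic∉tree : ∀ {e} → δ X (proj₁ colouring) e ≡ false → ¬ TreeEdge e
  monochromatic∉tree mono tree = contradiction (trans (sym mono) (proj₂ colouring tree)) λ ()

  oddChord : ¬ Bipartite X → (∀ {e f} → ¬ TreeEdge e → ¬ TreeEdge f → e ≡ f) → OddChord
  oddChord nonbipartite unique with f , mono ← monochromatic-edge nonbipartite = record
    { chord        = f
    ; spans        = spans
    ; chord-colour = mono
    }
    where
    spans : ∀ e → e ≡ _ ⊎ TreeEdge e
    spans e with treeEdge? e
    ... | yes tree = inj₂ tree
    ... | no ¬tree = inj₁ (unique ¬tree (monochromatic∉tree mono))

  -- The edge `e` lies on its fundamental cycle, which by uniqueness has the same edges as that of
  -- `f`; the only edge of the latter outside the tree is `f`.
  unicyclic⇒one-chord : Unicyclic X → ∀ {e f} → ¬ TreeEdge e → ¬ TreeEdge f → e ≡ f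
  unicyclic⇒one-chord U {e} {f} ¬e ¬f
    with C , e∈C , _ ← fundamental-cycle ¬e | D , _ , D⊆ ← fundamental-cycle ¬f
    with D⊆ e (Equivalence.from (proj₂ (U.unique D) e) (Equivalence.to (proj₂ (U.unique C) e) e∈C))
    where module U = Unicyclic U
  ... | inj₁ e≡f  = e≡f
  ... | inj₂ tree = contradiction tree ¬e

  -- Sending the root to e and every other vertex to its parent edge is
  -- injective; it misses f.
  square⇒one-chord : order ≡ size → ∀ {e f} → ¬ TreeEdge e → ¬ TreeEdge f → e ≡ f
  square⇒one-chord square {e} {f} ¬e ¬f = decidable-stable (e ≟ f) λ e≢f →
    no-injection-missing square h h-injective f (h-misses e≢f)
    where
    h : Vertex → Edge
    h v with v ≟ root
    ... | yes _ = e
    ... | no _  = parentEdge v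
    h-injective : ∀ {v w} → h v ≡ h w → v ≡ w
    h-injective {v} {w} eq with v ≟ root | w ≟ root
    ... | yes refl | yes refl = refl
    ... | yes _    | no w≢r   = contradiction (w , w≢r , sym eq) ¬e
    ... | no v≢r   | yes _    = contradiction (v , v≢r , eq) ¬e
    ... | no v≢r   | no w≢r   = parentEdge-injective v≢r w≢r eq
    h-misses : e ≢ f → ∀ v → f ≢ h v
    h-misses e≢f v eq with v ≟ root
    ... | yes _  = e≢f (sym eq)
    ... | no v≢r = ¬f (v , v≢r , sym eq)

-- Linear algebra over a commutative ring

↑ˡ≢↑ʳ : ∀ {m n} (i : Fin m) (j : Fin n) → i ↑ˡ n ≢ m ↑ʳ j
↑ˡ≢↑ʳ {m} {n} i j eq
  with () ← trans (sym (splitAt-↑ˡ m i n)) (trans (cong (splitAt m) eq) (splitAt-↑ʳ m n j))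

module LinearAlgebra (R : CommutativeRing 0ℓ 0ℓ) where
  open CommutativeRing R public
    hiding (zero)
    renaming (_≈_ to _≋_; _+_ to _⊕_; _*_ to _⊛_; -_ to ⊖_; refl to ≋-refl; sym to ≋-sym; trans to ≋-trans)
  open SemiringSum semiring public using (sum-cong-≋; ∑-comm; ∑-distrib-+; *-distribˡ-sum; *-distribʳ-sum)
    renaming (sum to ∑)
  open SingleTerm +-commutativeMonoid public using (sum-zero; sum-single)
  open RingProperties ring public using (-1*x≈-x; -‿involutive; +-cancelˡ)
  open SemiringSolver commutativeSemiring public using (solve; _:+_; _:*_; _:=_)
  open SetoidReasoning setoid

  Unit : Carrier → Set
  Unit x = ∃ λ y → x ⊛ y ≋ 1#

  ∑-↑ : ∀ m {n} (t : Fin (m ℕ.+ n) → Carrier) → ∑ t ≋ ∑ (λ i → t (i ↑ˡ n)) ⊕ ∑ (λ j → t (m ↑ʳ j))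
  ∑-↑ zero    t = ≋-sym (+-identityˡ (∑ t))
  ∑-↑ (suc m) {n} t = ≋-trans (+-congˡ (∑-↑ m (t ∘ suc)))
    (≋-sym (+-assoc (t zero) (∑ (λ i → t (suc (i ↑ˡ n)))) (∑ (λ j → t (suc (m ↑ʳ j))))))

  I : ∀ {n} → Fin n → Fin n → Carrier
  I i j = if does (i ≟ j) then 1# else 0#

  I-refl : ∀ {n} (i : Fin n) → I i i ≡ 1#
  I-refl i = cong (if_then 1# else 0#) (dec-true (i ≟ i) refl)

  I-≢ : ∀ {n} {i j : Fin n} → i ≢ j → I i j ≡ 0#
  I-≢ {i = i} {j} i≢j = cong (if_then 1# else 0#) (dec-false (i ≟ j) i≢j)

  I-embed : ∀ {m n} (f : Fin m → Fin n) → (∀ {i j} → f i ≡ f j → i ≡ j) → ∀ i j → I (f i) (f j) ≡ I i j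
  I-embed f f-inj i j with i ≟ j
  ... | yes refl = I-refl (f i)
  ... | no i≢j     = I-≢ (i≢j ∘ f-inj)

  I-sym : ∀ {n} (i j : Fin n) → I i j ≡ I j i
  I-sym i j with i ≟ j
  ... | yes refl = sym (I-refl i)
  ... | no i≢j     = sym (I-≢ (i≢j ∘ sym))

  ∑-I : ∀ {n} (z : Fin n → Carrier) i → ∑ (λ j → I i j ⊛ z j) ≋ z i
  ∑-I z i = begin
    ∑ (λ j → I i j ⊛ z j) ≈⟨ sum-single (λ j → I i j ⊛ z j) i (λ j j≢i →
                               ≋-trans (*-congʳ (reflexive (I-≢ (j≢i ∘ sym)))) (zeroˡ (z j))) ⟩
    I i i ⊛ z i           ≈⟨ *-congʳ (reflexive (I-refl i)) ⟩
    1# ⊛ z i              ≈⟨ *-identityˡ (z i) ⟩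
    z i                   ∎

  ∑-Iʳ : ∀ {n} (z : Fin n → Carrier) i → ∑ (λ j → z j ⊛ I j i) ≋ z i
  ∑-Iʳ z i = ≋-trans
    (sum-cong-≋ λ j → ≋-trans (*-comm (z j) (I j i)) (*-congʳ (reflexive (I-sym j i))))
    (∑-I z i)

  ∑-assoc : ∀ {m n} (x : Fin m → Carrier) (M : Fin m → Fin n → Carrier) (y : Fin n → Carrier) →
    ∑ (λ j → ∑ (λ i → x i ⊛ M i j) ⊛ y j) ≋ ∑ (λ i → x i ⊛ ∑ (λ j → M i j ⊛ y j))
  ∑-assoc x M y = begin
    ∑ (λ j → ∑ (λ i → x i ⊛ M i j) ⊛ y j) ≈⟨ sum-cong-≋ (λ j → *-distribʳ-sum (y j) (λ i → x i ⊛ M i j)) ⟩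
    ∑ (λ j → ∑ (λ i → x i ⊛ M i j ⊛ y j)) ≈⟨ ∑-comm (λ j i → x i ⊛ M i j ⊛ y j) ⟩
    ∑ (λ i → ∑ (λ j → x i ⊛ M i j ⊛ y j)) ≈⟨ sum-cong-≋ (λ i → sum-cong-≋ λ j → *-assoc (x i) (M i j) (y j)) ⟩
    ∑ (λ i → ∑ (λ j → x i ⊛ (M i j ⊛ y j))) ≈⟨ sum-cong-≋ (λ i → ≋-sym (*-distribˡ-sum (x i) (λ j → M i j ⊛ y j))) ⟩
    ∑ (λ i → x i ⊛ ∑ (λ j → M i j ⊛ y j)) ∎

  sign : Bool → Carrier
  sign b = if b then 1# else ⊖ 1#

  sign² : ∀ b → sign b ⊛ sign b ≋ 1#
  sign² true  = *-identityˡ 1#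
  sign² false = ≋-trans (-1*x≈-x (⊖ 1#)) (-‿involutive 1#)

  sign-opposite : ∀ a b → a xor b ≡ true → sign a ⊕ sign b ≋ 0#
  sign-opposite true  false _ = -‿inverseʳ 1#
  sign-opposite false true  _ = -‿inverseˡ 1#

  sign-zero⇒trivial : ∀ b → sign b ≋ 0# → 1# ≋ 0#
  sign-zero⇒trivial b eq = ≋-trans (≋-sym (sign² b)) (≋-trans (*-congˡ eq) (zeroʳ (sign b)))

  -- The numbers of rows and columns are kept independent, because their equality is a conclusion to
  -- be drawn from traces.
  record RectangularInverse {m n} (B : Fin m → Fin n → Carrier) : Set where
    field
      C  : Fin n → Fin m → Carrier
      BC : ∀ i j → ∑ (λ k → B i k ⊛ C k j) ≋ I i j
      CB : ∀ i j → ∑ (λ k → C i k ⊛ B k j) ≋ I i j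

  ones : ℕ → Carrier
  ones n = ∑ {n} (λ _ → 1#)

  ones-injective : (∀ n → ¬ ones (suc n) ≋ 0#) → ∀ {m n} → ones m ≋ ones n → m ≡ n
  ones-injective char-0 {zero}  {zero}  _  = refl
  ones-injective char-0 {zero}  {suc n} eq = contradiction (≋-sym eq) (char-0 n)
  ones-injective char-0 {suc m} {zero}  eq = contradiction eq (char-0 m)
  ones-injective char-0 {suc m} {suc n} eq =
    cong suc (ones-injective char-0 (+-cancelˡ 1# (ones m) (ones n) eq))

  trace-ones : ∀ {m n} {B : Fin m → Fin n → Carrier} → RectangularInverse B → ones m ≋ ones n
  trace-ones {m} {n} {B} inverse = begin
    ones m                            ≈⟨ sum-cong-≋ {m} (λ i → reflexive (sym (I-refl i))) ⟩
    ∑ {m} (λ i → I i i)               ≈⟨ sum-cong-≋ {m} (λ i → ≋-sym (BC i i)) ⟩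
    ∑ (λ i → ∑ (λ k → B i k ⊛ C k i)) ≈⟨ ∑-comm (λ i k → B i k ⊛ C k i) ⟩
    ∑ (λ k → ∑ (λ i → B i k ⊛ C k i)) ≈⟨ sum-cong-≋ (λ k → sum-cong-≋ λ i → *-comm (B i k) (C k i)) ⟩
    ∑ (λ k → ∑ (λ i → C k i ⊛ B i k)) ≈⟨ sum-cong-≋ {n} (λ k → CB k k) ⟩
    ∑ {n} (λ k → I k k)               ≈⟨ sum-cong-≋ {n} (λ k → reflexive (I-refl k)) ⟩
    ones n                            ∎
    where open RectangularInverse inverse

  left-kernel-trivial : ∀ {m n} {B : Fin m → Fin n → Carrier} → RectangularInverse B →
    ∀ z → (∀ k → ∑ (λ i → z i ⊛ B i k) ≋ 0#) → ∀ i → z i ≋ 0#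
  left-kernel-trivial {B = B} inverse z zB≋0 i = begin
    z i                                       ≈⟨ ≋-sym (∑-Iʳ z i) ⟩
    ∑ (λ j → z j ⊛ I j i)                     ≈⟨ sum-cong-≋ (λ j → *-congˡ (≋-sym (BC j i))) ⟩
    ∑ (λ j → z j ⊛ ∑ (λ k → B j k ⊛ C k i))   ≈⟨ ≋-sym (∑-assoc z B (λ k → C k i)) ⟩
    ∑ (λ k → ∑ (λ j → z j ⊛ B j k) ⊛ C k i)   ≈⟨ sum-zero _ (λ k → ≋-trans (*-congʳ (zB≋0 k)) (zeroˡ (C k i))) ⟩
    0#                                        ∎
    where open RectangularInverse inverse

  -- By associativity L = L(BC) = (LB)C = C.
  left∧right⇒inverse : ∀ {m n} {B : Fin m → Fin n → Carrier} (L C : Fin n → Fin m → Carrier) →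
    (∀ i j → ∑ (λ k → L i k ⊛ B k j) ≋ I i j) → (∀ i j → ∑ (λ k → B i k ⊛ C k j) ≋ I i j) →
    RectangularInverse B
  left∧right⇒inverse {B = B} L C LB BC = record
    { C  = C
    ; BC = BC
    ; CB = λ i j → ≋-trans (sum-cong-≋ λ k → *-congʳ (≋-sym (L≋C i k))) (LB i j)
    }
    where
    L≋C : ∀ i k → L i k ≋ C i k
    L≋C i k = begin
      L i k                                     ≈⟨ ≋-sym (∑-Iʳ (L i) k) ⟩
      ∑ (λ j → L i j ⊛ I j k)                   ≈⟨ sum-cong-≋ (λ j → *-congˡ (≋-sym (BC j k))) ⟩
      ∑ (λ j → L i j ⊛ ∑ (λ l → B j l ⊛ C l k)) ≈⟨ ≋-sym (∑-assoc (L i) B (λ l → C l k)) ⟩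
      ∑ (λ l → ∑ (λ j → L i j ⊛ B j l) ⊛ C l k) ≈⟨ sum-cong-≋ (λ l → *-congʳ (LB i l)) ⟩
      ∑ (λ l → I i l ⊛ C l k)                   ≈⟨ ∑-I (λ l → C l k) i ⟩
      C i k                                     ∎

  -- The matrix M is [0 B; Bᵀ 0] in block form.
  module Blocks {m n} (B : Fin m → Fin n → Carrier) (M : Fin (m ℕ.+ n) → Fin (m ℕ.+ n) → Carrier)
    (M-ll : ∀ i j → M (i ↑ˡ n) (j ↑ˡ n) ≋ 0#) (M-rr : ∀ i j → M (m ↑ʳ i) (m ↑ʳ j) ≋ 0#)
    (M-lr : ∀ i j → M (i ↑ˡ n) (m ↑ʳ j) ≋ B i j) (M-rl : ∀ i j → M (m ↑ʳ j) (i ↑ˡ n) ≋ B i j) where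

    private
      0*≋0 : ∀ {x} y → x ≋ 0# → x ⊛ y ≋ 0#
      0*≋0 y x≋0 = ≋-trans (*-congʳ x≋0) (zeroˡ y)

      *0≋0 : ∀ x {y} → y ≋ 0# → x ⊛ y ≋ 0#
      *0≋0 x y≋0 = ≋-trans (*-congˡ y≋0) (zeroʳ x)

    module _ (N : Fin (m ℕ.+ n) → Fin (m ℕ.+ n) → Carrier)
      (MN : ∀ i j → ∑ (λ k → M i k ⊛ N k j) ≋ I i j) (NM : ∀ i j → ∑ (λ k → N i k ⊛ M k j) ≋ I i j) where

      blocks⇒inverse : RectangularInverse B
      blocks⇒inverse = record
        { C  = λ k i → N (m ↑ʳ k) (i ↑ˡ n)
        ; BC = λ i j → begin
            ∑ (λ k → B i k ⊛ N (m ↑ʳ k) (j ↑ˡ n))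
              ≈⟨ sum-cong-≋ (λ k → *-congʳ (≋-sym (M-lr i k))) ⟩
            ∑ (λ k → M (i ↑ˡ n) (m ↑ʳ k) ⊛ N (m ↑ʳ k) (j ↑ˡ n))
              ≈⟨ ≋-sym (+-identityˡ _) ⟩
            0# ⊕ ∑ (λ k → M (i ↑ˡ n) (m ↑ʳ k) ⊛ N (m ↑ʳ k) (j ↑ˡ n))
              ≈⟨ +-congʳ (≋-sym (sum-zero _ (λ k → 0*≋0 (N (k ↑ˡ n) (j ↑ˡ n)) (M-ll i k)))) ⟩
            ∑ (λ k → M (i ↑ˡ n) (k ↑ˡ n) ⊛ N (k ↑ˡ n) (j ↑ˡ n))
              ⊕ ∑ (λ k → M (i ↑ˡ n) (m ↑ʳ k) ⊛ N (m ↑ʳ k) (j ↑ˡ n))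
              ≈⟨ ≋-sym (∑-↑ m (λ k → M (i ↑ˡ n) k ⊛ N k (j ↑ˡ n))) ⟩
            ∑ (λ k → M (i ↑ˡ n) k ⊛ N k (j ↑ˡ n))
              ≈⟨ MN (i ↑ˡ n) (j ↑ˡ n) ⟩
            I (i ↑ˡ n) (j ↑ˡ n)
              ≡⟨ I-embed (_↑ˡ n) (↑ˡ-injective n _ _) i j ⟩
            I i j ∎
        ; CB = λ i j → begin
            ∑ (λ k → N (m ↑ʳ i) (k ↑ˡ n) ⊛ B k j)
              ≈⟨ sum-cong-≋ (λ k → *-congˡ (≋-sym (M-lr k j))) ⟩
            ∑ (λ k → N (m ↑ʳ i) (k ↑ˡ n) ⊛ M (k ↑ˡ n) (m ↑ʳ j))
              ≈⟨ ≋-sym (+-identityʳ _) ⟩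
            ∑ (λ k → N (m ↑ʳ i) (k ↑ˡ n) ⊛ M (k ↑ˡ n) (m ↑ʳ j)) ⊕ 0#
              ≈⟨ +-congˡ (≋-sym (sum-zero _ (λ k → *0≋0 (N (m ↑ʳ i) (m ↑ʳ k)) (M-rr k j)))) ⟩
            ∑ (λ k → N (m ↑ʳ i) (k ↑ˡ n) ⊛ M (k ↑ˡ n) (m ↑ʳ j))
              ⊕ ∑ (λ k → N (m ↑ʳ i) (m ↑ʳ k) ⊛ M (m ↑ʳ k) (m ↑ʳ j))
              ≈⟨ ≋-sym (∑-↑ m (λ k → N (m ↑ʳ i) k ⊛ M k (m ↑ʳ j))) ⟩
            ∑ (λ k → N (m ↑ʳ i) k ⊛ M k (m ↑ʳ j))
              ≈⟨ NM (m ↑ʳ i) (m ↑ʳ j) ⟩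
            I (m ↑ʳ i) (m ↑ʳ j)
              ≡⟨ I-embed (m ↑ʳ_) (↑ʳ-injective m _ _) i j ⟩
            I i j ∎
        }

    -- The inverse is [0 Cᵀ; C 0]; it is symmetric, as is M, so that one of
    -- the two products determines the other.
    module _ (inverse : RectangularInverse B) where
      open RectangularInverse inverse

      N′ : Fin m ⊎ Fin n → Fin m ⊎ Fin n → Carrier
      N′ (inj₁ i) (inj₂ k) = C k i
      N′ (inj₂ k) (inj₁ i) = C k i
      N′ (inj₁ _) (inj₁ _) = 0#
      N′ (inj₂ _) (inj₂ _) = 0#

      N : Fin (m ℕ.+ n) → Fin (m ℕ.+ n) → Carrier
      N i j = N′ (splitAt m i) (splitAt m j)

      N-sym : ∀ i j → N i j ≡ N j i
      N-sym i j with splitAt m i | splitAt m j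
      ... | inj₁ _ | inj₁ _ = refl
      ... | inj₁ _ | inj₂ _ = refl
      ... | inj₂ _ | inj₁ _ = refl
      ... | inj₂ _ | inj₂ _ = refl

      ↑-cases : (P : Fin (m ℕ.+ n) → Set) → (∀ i → P (i ↑ˡ n)) → (∀ k → P (m ↑ʳ k)) → ∀ x → P x
      ↑-cases P l r x with splitAt m x in eq
      ... | inj₁ i = subst P (splitAt⁻¹-↑ˡ eq) (l i)
      ... | inj₂ k = subst P (splitAt⁻¹-↑ʳ eq) (r k)

      M-sym : ∀ x y → M x y ≋ M y x
      M-sym = ↑-cases _
        (λ i → ↑-cases _ (λ j → ≋-trans (M-ll i j) (≋-sym (M-ll j i)))
                 (λ k → ≋-trans (M-lr i k) (≋-sym (M-rl i k))))
        (λ k → ↑-cases _ (λ i → ≋-trans (M-rl i k) (≋-sym (M-lr i k)))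
                 (λ l → ≋-trans (M-rr k l) (≋-sym (M-rr l k))))

      product : ∀ x y → ∑ (λ k → M x k ⊛ N k y) ≋
        ∑ (λ k → M x (k ↑ˡ n) ⊛ N′ (inj₁ k) (splitAt m y)) ⊕ ∑ (λ k → M x (m ↑ʳ k) ⊛ N′ (inj₂ k) (splitAt m y))
      product x y = ≋-trans (∑-↑ m (λ k → M x k ⊛ N k y)) (+-cong
        (sum-cong-≋ λ k → *-congˡ (reflexive (cong (λ s → N′ s (splitAt m y)) (splitAt-↑ˡ m k n))))
        (sum-cong-≋ λ k → *-congˡ (reflexive (cong (λ s → N′ s (splitAt m y)) (splitAt-↑ʳ m n k)))))

      MN : ∀ x y → ∑ (λ k → M x k ⊛ N k y) ≋ I x y
      MN = ↑-cases _
        (λ i → ↑-cases _ (ll i) (lr i))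
        (λ k → ↑-cases _ (rl k) (rr k))
        where
        ll : ∀ i j → ∑ (λ k → M (i ↑ˡ n) k ⊛ N k (j ↑ˡ n)) ≋ I (i ↑ˡ n) (j ↑ˡ n)
        ll i j with p ← product (i ↑ˡ n) (j ↑ˡ n) rewrite splitAt-↑ˡ m j n = begin
          _ ≈⟨ p ⟩
          _ ≈⟨ +-cong (sum-zero _ (λ k → *0≋0 (M (i ↑ˡ n) (k ↑ˡ n)) ≋-refl))
                       (sum-cong-≋ (λ k → *-congʳ (M-lr i k))) ⟩
          0# ⊕ ∑ (λ k → B i k ⊛ C k j) ≈⟨ +-identityˡ _ ⟩
          ∑ (λ k → B i k ⊛ C k j) ≈⟨ BC i j ⟩
          I i j ≡⟨ I-embed (_↑ˡ n) (↑ˡ-injective n _ _) i j ⟨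
          I (i ↑ˡ n) (j ↑ˡ n) ∎
        lr : ∀ i j → ∑ (λ k → M (i ↑ˡ n) k ⊛ N k (m ↑ʳ j)) ≋ I (i ↑ˡ n) (m ↑ʳ j)
        lr i j with p ← product (i ↑ˡ n) (m ↑ʳ j) rewrite splitAt-↑ʳ m n j = begin
          _ ≈⟨ p ⟩
          _ ≈⟨ +-cong (sum-zero _ (λ k → 0*≋0 (C j k) (M-ll i k)))
                       (sum-zero _ (λ k → *0≋0 (M (i ↑ˡ n) (m ↑ʳ k)) ≋-refl)) ⟩
          0# ⊕ 0# ≈⟨ +-identityˡ 0# ⟩
          0# ≡⟨ I-≢ (↑ˡ≢↑ʳ i j) ⟨
          I (i ↑ˡ n) (m ↑ʳ j) ∎
        rl : ∀ i j → ∑ (λ k → M (m ↑ʳ i) k ⊛ N k (j ↑ˡ n)) ≋ I (m ↑ʳ i) (j ↑ˡ n)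
        rl i j with p ← product (m ↑ʳ i) (j ↑ˡ n) rewrite splitAt-↑ˡ m j n = begin
          _ ≈⟨ p ⟩
          _ ≈⟨ +-cong (sum-zero _ (λ k → *0≋0 (M (m ↑ʳ i) (k ↑ˡ n)) ≋-refl))
                       (sum-zero _ (λ k → 0*≋0 (C k j) (M-rr i k))) ⟩
          0# ⊕ 0# ≈⟨ +-identityˡ 0# ⟩
          0# ≡⟨ I-≢ (↑ˡ≢↑ʳ j i ∘ sym) ⟨
          I (m ↑ʳ i) (j ↑ˡ n) ∎
        rr : ∀ i j → ∑ (λ k → M (m ↑ʳ i) k ⊛ N k (m ↑ʳ j)) ≋ I (m ↑ʳ i) (m ↑ʳ j)
        rr i j with p ← product (m ↑ʳ i) (m ↑ʳ j) rewrite splitAt-↑ʳ m n j = begin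
          _ ≈⟨ p ⟩
          _ ≈⟨ +-cong (sum-cong-≋ (λ k → ≋-trans (*-congʳ (M-rl k i)) (*-comm (B k i) (C j k))))
                       (sum-zero _ (λ k → *0≋0 (M (m ↑ʳ i) (m ↑ʳ k)) ≋-refl)) ⟩
          ∑ (λ k → C j k ⊛ B k i) ⊕ 0# ≈⟨ +-identityʳ _ ⟩
          ∑ (λ k → C j k ⊛ B k i) ≈⟨ CB j i ⟩
          I j i ≡⟨ trans (I-sym j i) (sym (I-embed (m ↑ʳ_) (↑ʳ-injective m _ _) i j)) ⟩
          I (m ↑ʳ i) (m ↑ʳ j) ∎

      NM : ∀ x y → ∑ (λ k → N x k ⊛ M k y) ≋ I x y
      NM x y = begin
        ∑ (λ k → N x k ⊛ M k y) ≈⟨ sum-cong-≋ (λ k → ≋-trans (*-comm (N x k) (M k y))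
                                     (*-cong (M-sym k y) (reflexive (N-sym x k)))) ⟩
        ∑ (λ k → M y k ⊛ N k x) ≈⟨ MN y x ⟩
        I y x                   ≡⟨ I-sym y x ⟩
        I x y                   ∎

-- The weighted incidence matrix

module Incidence (R : CommutativeRing 0ℓ 0ℓ) (X : WeightedGraph)
  (weight : WeightedGraph.Edge X → CommutativeRing.Carrier R) where
  open WeightedGraph X hiding (weight)
  open LinearAlgebra R public
  open SetoidReasoning setoid

  ends-sum : (Vertex → Carrier) → Edge → Carrier
  ends-sum z e = z (proj₁ (ends e)) ⊕ z (proj₂ (ends e))

  ends-sum-joins : ∀ z {e u v} → Joins e u v → ends-sum z e ≋ z u ⊕ z v
  ends-sum-joins z                 (inj₁ eq) rewrite eq = ≋-refl
  ends-sum-joins z {u = u} {v = v} (inj₂ eq) rewrite eq = +-comm (z v) (z u)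

  -- The factor `ends-sum (I v) e` counts the ends of `e` that equal `v`.
  B : Vertex → Edge → Carrier
  B v e = weight e ⊛ ends-sum (I v) e

  B-source : ∀ {v e} → v ≡ proj₁ (ends e) → v ≢ proj₂ (ends e) → B v e ≋ weight e
  B-source {v} {e} refl v≢y = begin
    weight e ⊛ (I v v ⊕ I v (proj₂ (ends e)))
      ≈⟨ *-congˡ (+-cong (reflexive (I-refl v)) (reflexive (I-≢ v≢y))) ⟩
    weight e ⊛ (1# ⊕ 0#) ≈⟨ *-congˡ (+-identityʳ 1#) ⟩
    weight e ⊛ 1#        ≈⟨ *-identityʳ (weight e) ⟩
    weight e             ∎

  B-target : ∀ {v e} → v ≢ proj₁ (ends e) → v ≡ proj₂ (ends e) → B v e ≋ weight e
  B-target {v} {e} v≢x refl = begin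
    weight e ⊛ (I v (proj₁ (ends e)) ⊕ I v v)
      ≈⟨ *-congˡ (+-cong (reflexive (I-≢ v≢x)) (reflexive (I-refl v))) ⟩
    weight e ⊛ (0# ⊕ 1#) ≈⟨ *-congˡ (+-identityˡ 1#) ⟩
    weight e ⊛ 1#        ≈⟨ *-identityʳ (weight e) ⟩
    weight e             ∎

  B-other : ∀ {v e} → v ≢ proj₁ (ends e) → v ≢ proj₂ (ends e) → B v e ≋ 0#
  B-other {v} {e} v≢x v≢y = begin
    weight e ⊛ (I v (proj₁ (ends e)) ⊕ I v (proj₂ (ends e)))
      ≈⟨ *-congˡ (+-cong (reflexive (I-≢ v≢x)) (reflexive (I-≢ v≢y))) ⟩
    weight e ⊛ (0# ⊕ 0#) ≈⟨ *-congˡ (+-identityʳ 0#) ⟩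
    weight e ⊛ 0#        ≈⟨ zeroʳ (weight e) ⟩
    0#                   ∎

  -- Each Kronecker delta picks out one end of `e`. This turns questions about the left kernel and
  -- left inverses of `B` into questions about sums over the two ends of an edge.
  ∑-B : ∀ z e → ∑ (λ v → z v ⊛ B v e) ≋ weight e ⊛ ends-sum z e
  ∑-B z e = begin
    ∑ (λ v → z v ⊛ B v e)
      ≈⟨ sum-cong-≋ (λ v → rearrange (z v) (weight e) (I v x) (I v y)) ⟩
    ∑ (λ v → weight e ⊛ (z v ⊛ I v x ⊕ z v ⊛ I v y))
      ≈⟨ ≋-sym (*-distribˡ-sum (weight e) (λ v → z v ⊛ I v x ⊕ z v ⊛ I v y)) ⟩
    weight e ⊛ ∑ (λ v → z v ⊛ I v x ⊕ z v ⊛ I v y)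
      ≈⟨ *-congˡ (∑-distrib-+ (λ v → z v ⊛ I v x) (λ v → z v ⊛ I v y)) ⟩
    weight e ⊛ (∑ (λ v → z v ⊛ I v x) ⊕ ∑ (λ v → z v ⊛ I v y))
      ≈⟨ *-congˡ (+-cong (∑-Iʳ z x) (∑-Iʳ z y)) ⟩
    weight e ⊛ ends-sum z e ∎
    where
    x = proj₁ (ends e)
    y = proj₂ (ends e)
    rearrange : ∀ z w a b → z ⊛ (w ⊛ (a ⊕ b)) ≋ w ⊛ (z ⊛ a ⊕ z ⊛ b)
    rearrange = solve 4 (λ z w a b → z :* (w :* (a :+ b)) := w :* (z :* a :+ z :* b)) ≋-refl

  -- The signs of a 2-colouring cancel at the ends of every edge, so an inverse of `B` would make a
  -- sign zero; its square is 1, which would collapse the ring.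
  inverse⇒nonbipartite : (∀ n → ¬ ones (suc n) ≋ 0#) → RectangularInverse B → Vertex →
    ¬ Bipartite X
  inverse⇒nonbipartite char-0 inverse v (c , δc) = char-0 0 (≋-trans (+-identityʳ 1#) $ sign-zero⇒trivial (c v)
    (left-kernel-trivial inverse (sign ∘ c)
      (λ e → ≋-trans (∑-B (sign ∘ c) e) (≋-trans (*-congˡ (sign-opposite _ _ (δc e))) (zeroʳ (weight e)))) v))

  -- Inverting the incidence matrix by means of an odd chord

  module Sufficiency (T : SpanningTree X) (odd : Chords.OddChord T)
    (weight-unit : ∀ e → Unit (weight e)) (½ : Carrier) (½+½≋1 : ½ ⊕ ½ ≋ 1#) where
    open Tree T
    open Chords T
    open OddChord odd

    weight⁻¹ : Edge → Carrier
    weight⁻¹ e = proj₁ (weight-unit e)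

    colour : Vertex → Bool
    colour = proj₁ colouring

    u₀ v₀ : Vertex
    u₀ = proj₁ (ends chord)
    v₀ = proj₂ (ends chord)

    u₀≈v₀ : colour u₀ ≡ colour v₀
    u₀≈v₀ = xor-false⇒≡ (colour u₀) (colour v₀) chord-colour

    -- The recurrence `z₀` satisfies the equations on tree edges. Adding a multiple of the signs `σ`
    -- preserves these, as tree edges have ends of opposite sign, while the chord, whose ends have
    -- equal signs, can be corrected.
    solve-ends-sum : (g : Edge → Carrier) → ∃ λ z → ∀ e → ends-sum z e ≋ g e
    solve-ends-sum g = z , λ e → ≋-trans (linear e) (correct e (spans e))
      where
      open Recursion 0# (λ v x → g (parentEdge v) ⊕ ⊖ x) renaming (rec to z₀)
      σ : Vertex → Carrier
      σ = sign ∘ colour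
      d t : Carrier
      d = g chord ⊕ ⊖ ends-sum z₀ chord
      -- The sum of `σ` at the chord is 2 σ(u₀) and σ(u₀)² = 1, so this multiple contributes exactly
      -- the defect `d`.
      t = ½ ⊛ σ u₀ ⊛ d
      z : Vertex → Carrier
      z v = z₀ v ⊕ t ⊛ σ v
      linear : ∀ e → ends-sum z e ≋ ends-sum z₀ e ⊕ t ⊛ ends-sum σ e
      linear e = solve 5
        (λ a b t x y → (a :+ t :* x) :+ (b :+ t :* y) := (a :+ b) :+ t :* (x :+ y)) ≋-refl
        (z₀ (proj₁ (ends e))) (z₀ (proj₂ (ends e))) t (σ (proj₁ (ends e))) (σ (proj₂ (ends e)))
      cancel : ∀ a x → (a ⊕ ⊖ x) ⊕ x ≋ a
      cancel a x = ≋-trans (+-assoc a (⊖ x) x) (≋-trans (+-congˡ (-‿inverseˡ x)) (+-identityʳ a))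
      correct : ∀ e → e ≡ chord ⊎ TreeEdge e → ends-sum z₀ e ⊕ t ⊛ ends-sum σ e ≋ g e
      correct e (inj₁ refl) = begin
        Z ⊕ t ⊛ (σ u₀ ⊕ σ v₀) ≡⟨ cong (λ b → Z ⊕ t ⊛ (σ u₀ ⊕ sign b)) u₀≈v₀ ⟨
        Z ⊕ t ⊛ (σ u₀ ⊕ σ u₀) ≈⟨ +-congˡ (solve 3
          (λ h s d → (h :* s :* d) :* (s :+ s) := (h :+ h) :* (s :* s) :* d) ≋-refl ½ (σ u₀) d) ⟩
        Z ⊕ (½ ⊕ ½) ⊛ (σ u₀ ⊛ σ u₀) ⊛ d
          ≈⟨ +-congˡ (*-congʳ (≋-trans (*-cong ½+½≋1 (sign² (colour u₀))) (*-identityˡ 1#))) ⟩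
        Z ⊕ 1# ⊛ d ≈⟨ +-congˡ (*-identityˡ d) ⟩
        Z ⊕ d ≈⟨ +-comm Z d ⟩
        d ⊕ Z ≈⟨ cancel (g chord) Z ⟩
        g chord ∎
        where Z = ends-sum z₀ chord
      correct e (inj₂ tree@(v , v≢r , refl)) = begin
        ends-sum z₀ e ⊕ t ⊛ ends-sum σ e
          ≈⟨ +-cong (ends-sum-joins z₀ (parentEdge-joins v≢r)) (*-congˡ (sign-opposite _ _ (proj₂ colouring tree))) ⟩
        (z₀ v ⊕ z₀ (parent v)) ⊕ t ⊛ 0#
          ≈⟨ +-cong (+-congʳ (reflexive (rec-parent v≢r))) (zeroʳ t) ⟩
        ((g e ⊕ ⊖ z₀ (parent v)) ⊕ z₀ (parent v)) ⊕ 0# ≈⟨ +-identityʳ _ ⟩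
        (g e ⊕ ⊖ z₀ (parent v)) ⊕ z₀ (parent v) ≈⟨ cancel (g e) (z₀ (parent v)) ⟩
        g e ∎

    -- By `∑-B`, row `e` of a left inverse needs weighted end sums `I e`, hence unweighted ones
    -- divided by the weights.
    L : Edge → Vertex → Carrier
    L e = proj₁ (solve-ends-sum (λ f → weight⁻¹ f ⊛ I e f))

    LB : ∀ e f → ∑ (λ v → L e v ⊛ B v f) ≋ I e f
    LB e f = begin
      ∑ (λ v → L e v ⊛ B v f)        ≈⟨ ∑-B (L e) f ⟩
      weight f ⊛ ends-sum (L e) f    ≈⟨ *-congˡ (proj₂ (solve-ends-sum (λ f → weight⁻¹ f ⊛ I e f)) f) ⟩
      weight f ⊛ (weight⁻¹ f ⊛ I e f) ≈⟨ ≋-sym (*-assoc (weight f) (weight⁻¹ f) (I e f)) ⟩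
      weight f ⊛ weight⁻¹ f ⊛ I e f   ≈⟨ *-congʳ (proj₂ (weight-unit f)) ⟩
      1# ⊛ I e f                      ≈⟨ *-identityˡ (I e f) ⟩
      I e f                           ∎

    -- Membership in the column space of `B`, with the preimage as data, since preimages of basis
    -- vectors are the columns of the right inverse.
    record InImage (b : Vertex → Carrier) : Set where
      constructor image
      field
        preimage : Edge → Carrier
        equation : ∀ u → ∑ (λ e → B u e ⊛ preimage e) ≋ b u

    image-cong : ∀ {b b′} → (∀ u → b u ≋ b′ u) → InImage b → InImage b′
    image-cong b≋b′ (image y By) = image y λ u → ≋-trans (By u) (b≋b′ u)

    image-combine : ∀ {b b′} k → InImage b → InImage b′ → InImage (λ u → b u ⊕ k ⊛ b′ u)
    image-combine {b} {b′} k (image y By) (image y′ By′) = image (λ e → y e ⊕ k ⊛ y′ e) λ u → begin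
      ∑ (λ e → B u e ⊛ (y e ⊕ k ⊛ y′ e))
        ≈⟨ sum-cong-≋ (λ e → solve 4 (λ b y k y′ → b :* (y :+ k :* y′) := b :* y :+ k :* (b :* y′))
             ≋-refl (B u e) (y e) k (y′ e)) ⟩
      ∑ (λ e → B u e ⊛ y e ⊕ k ⊛ (B u e ⊛ y′ e))
        ≈⟨ ∑-distrib-+ (λ e → B u e ⊛ y e) (λ e → k ⊛ (B u e ⊛ y′ e)) ⟩
      ∑ (λ e → B u e ⊛ y e) ⊕ ∑ (λ e → k ⊛ (B u e ⊛ y′ e))
        ≈⟨ +-cong (By u) (≋-trans (≋-sym (*-distribˡ-sum k (λ e → B u e ⊛ y′ e))) (*-congˡ (By′ u))) ⟩
      b u ⊕ k ⊛ b′ u ∎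

    image-zero : InImage (λ _ → 0#)
    image-zero = image (λ _ → 0#) λ u → sum-zero _ λ e → zeroʳ (B u e)

    image-cancel : ∀ {b b′} → InImage (λ u → b u ⊕ b′ u) → InImage b′ → InImage b
    image-cancel {b} {b′} h h′ = image-cong (λ u → begin
      (b u ⊕ b′ u) ⊕ ⊖ 1# ⊛ b′ u ≈⟨ +-congˡ (-1*x≈-x (b′ u)) ⟩
      (b u ⊕ b′ u) ⊕ ⊖ b′ u      ≈⟨ +-assoc (b u) (b′ u) (⊖ b′ u) ⟩
      b u ⊕ (b′ u ⊕ ⊖ b′ u)      ≈⟨ +-congˡ (-‿inverseʳ (b′ u)) ⟩
      b u ⊕ 0#                   ≈⟨ +-identityʳ (b u) ⟩
      b u                        ∎) (image-combine (⊖ 1#) h h′)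

    image-scale : ∀ {b} k → InImage b → InImage (λ u → k ⊛ b u)
    image-scale k h = image-cong (λ u → +-identityˡ _) (image-combine k image-zero h)

    -- This vector is column `e` of `B` divided by the weight of `e`.
    image-edge : ∀ e → InImage (λ u → ends-sum (I u) e)
    image-edge e = image (λ f → weight⁻¹ f ⊛ I f e) λ u → begin
      ∑ (λ f → B u f ⊛ (weight⁻¹ f ⊛ I f e)) ≈⟨ sum-cong-≋ (λ f → ≋-sym (*-assoc (B u f) (weight⁻¹ f) (I f e))) ⟩
      ∑ (λ f → (B u f ⊛ weight⁻¹ f) ⊛ I f e) ≈⟨ ∑-Iʳ (λ f → B u f ⊛ weight⁻¹ f) e ⟩
      (weight e ⊛ ends-sum (I u) e) ⊛ weight⁻¹ e
        ≈⟨ solve 3 (λ w s w′ → (w :* s) :* w′ := (w :* w′) :* s) ≋-refl (weight e) (ends-sum (I u) e) (weight⁻¹ e) ⟩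
      (weight e ⊛ weight⁻¹ e) ⊛ ends-sum (I u) e ≈⟨ *-congʳ (proj₂ (weight-unit e)) ⟩
      1# ⊛ ends-sum (I u) e                      ≈⟨ *-identityˡ _ ⟩
      ends-sum (I u) e                           ∎

    -- The value is -1 at vertices coloured like the root and 1 at the others, so that I v + κ(v) I
    -- root vanishes for v = root.
    κ : Vertex → Carrier
    κ v = sign (colour v xor colour root)

    -- Alternating sums of edges along the tree path from v to the root.
    image-tree : ∀ v → InImage (λ u → I u v ⊕ κ v ⊛ I u root)
    image-tree = tree-induction _
      (image-cong (λ u → ≋-sym (begin
        I u root ⊕ κ root ⊛ I u root ≡⟨ cong (λ b → I u root ⊕ sign b ⊛ I u root) (xor-same (colour root)) ⟩
        I u root ⊕ ⊖ 1# ⊛ I u root   ≈⟨ +-congˡ (-1*x≈-x (I u root)) ⟩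
        I u root ⊕ ⊖ I u root        ≈⟨ -‿inverseʳ (I u root) ⟩
        0#                           ∎)) image-zero)
      -- The vectors claimed for `v` and for its parent add up to that of the parent edge, since
      -- their root coefficients are opposite; subtracting the one for the parent leaves that for
      -- `v`.
      λ {v} v≢r h → image-cancel (image-cong (λ u → begin
        ends-sum (I u) (parentEdge v) ≈⟨ ends-sum-joins (I u) (parentEdge-joins v≢r) ⟩
        I u v ⊕ I u (parent v)        ≈⟨ ≋-sym (+-identityʳ _) ⟩
        (I u v ⊕ I u (parent v)) ⊕ 0# ≈⟨ +-congˡ (≋-sym (≋-trans (*-congʳ (opposite v≢r)) (zeroˡ (I u root)))) ⟩
        (I u v ⊕ I u (parent v)) ⊕ (κ v ⊕ κ (parent v)) ⊛ I u root
          ≈⟨ solve 5 (λ a b k l r → (a :+ b) :+ (k :+ l) :* r := (a :+ k :* r) :+ (b :+ l :* r))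
               ≋-refl (I u v) (I u (parent v)) (κ v) (κ (parent v)) (I u root) ⟩
        (I u v ⊕ κ v ⊛ I u root) ⊕ (I u (parent v) ⊕ κ (parent v) ⊛ I u root) ∎)
        (image-edge (parentEdge v))) h
      where
      shift : ∀ a b r → a xor b ≡ true → (a xor r) xor (b xor r) ≡ true
      shift true  false true  _ = refl
      shift true  false false _ = refl
      shift false true  true  _ = refl
      shift false true  false _ = refl
      opposite : ∀ {v} → v ≢ root → κ v ⊕ κ (parent v) ≋ 0#
      opposite {v} v≢r = sign-opposite _ _ (shift (colour v) (colour (parent v)) (colour root)
        (trans (sym (δ-joins X colour (parentEdge-joins v≢r))) (proj₂ colouring (v , v≢r , refl))))

    -- Adding the vectors of `image-tree` at the two ends of the chord and subtracting that of the
    -- chord leaves 2 κ(u₀) times the root vector, the ends having equal colours. The factor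
    -- `½ ⊛ κ u₀` inverts this coefficient.
    image-root : InImage (λ u → I u root)
    image-root = image-cong (λ u → begin
        ½ ⊛ κ u₀ ⊛ ((κ u₀ ⊕ κ v₀) ⊛ I u root)
          ≡⟨ cong (λ b → ½ ⊛ κ u₀ ⊛ ((κ u₀ ⊕ sign (b xor colour root)) ⊛ I u root)) u₀≈v₀ ⟨
        ½ ⊛ κ u₀ ⊛ ((κ u₀ ⊕ κ u₀) ⊛ I u root)
          ≈⟨ solve 3 (λ h k i → h :* k :* ((k :+ k) :* i) := (h :+ h) :* (k :* k) :* i) ≋-refl ½ (κ u₀) (I u root) ⟩
        (½ ⊕ ½) ⊛ (κ u₀ ⊛ κ u₀) ⊛ I u root
          ≈⟨ *-congʳ (≋-trans (*-cong ½+½≋1 (sign² (colour u₀ xor colour root))) (*-identityˡ 1#)) ⟩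
        1# ⊛ I u root ≈⟨ *-identityˡ (I u root) ⟩
        I u root ∎)
      (image-scale (½ ⊛ κ u₀) (image-cancel (image-cong (λ u → begin
          (I u u₀ ⊕ κ u₀ ⊛ I u root) ⊕ 1# ⊛ (I u v₀ ⊕ κ v₀ ⊛ I u root)
            ≈⟨ +-congˡ (*-identityˡ _) ⟩
          (I u u₀ ⊕ κ u₀ ⊛ I u root) ⊕ (I u v₀ ⊕ κ v₀ ⊛ I u root)
            ≈⟨ solve 5 (λ a b k l r → (a :+ k :* r) :+ (b :+ l :* r) := (k :+ l) :* r :+ (a :+ b))
                 ≋-refl (I u u₀) (I u v₀) (κ u₀) (κ v₀) (I u root) ⟩
          (κ u₀ ⊕ κ v₀) ⊛ I u root ⊕ ends-sum (I u) chord ∎)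
        (image-combine 1# (image-tree u₀) (image-tree v₀)))
        (image-edge chord)))

    image-vertex : ∀ v → InImage (λ u → I u v)
    image-vertex v = image-cancel (image-tree v) (image-scale (κ v) image-root)

    inverse : RectangularInverse B
    inverse = left∧right⇒inverse L (λ e v → InImage.preimage (image-vertex v) e) LB
      λ u v → InImage.equation (image-vertex v) u

-- The adjacency matrix of the subdivision

≥1⇒≉0 : ∀ x → (∀ k → 1ℚ ℚ.≤ seq x k) → ¬ x ≈ 0ℝ
≥1⇒≉0 x 1≤x (mk≈ h) with N , small ← h 1ℚ (ℚₚ.positive⁻¹ 1ℚ) = ℚₚ.<-irrefl refl $
  ℚₚ.≤-<-trans (subst (1ℚ ℚ.≤_) (sym ∣x∣≡x) (1≤x N)) (small N ℕₚ.≤-refl)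
  where
  ∣x∣≡x : ∀ {N} → ∣ seq x N ℚ.- 0ℚ ∣ ≡ seq x N
  ∣x∣≡x {N} = trans (cong ∣_∣ (ℚₚ.+-identityʳ (seq x N)))
    (ℚₚ.0≤p⇒∣p∣≡p (ℚₚ.≤-trans (ℚₚ.<⇒≤ (ℚₚ.positive⁻¹ 1ℚ)) (1≤x N)))

module _ where
  open LinearAlgebra ℝ-commutativeRing using (ones; _≋_; 0#)

  ones-nonNeg : ∀ n k → 0ℚ ℚ.≤ seq (ones n) k
  ones-nonNeg zero    k = ℚₚ.≤-refl
  ones-nonNeg (suc n) k = ℚₚ.+-mono-≤ (ℚₚ.<⇒≤ (ℚₚ.positive⁻¹ 1ℚ)) (ones-nonNeg n k)

  ones-≥1 : ∀ n k → 1ℚ ℚ.≤ seq (ones (suc n)) k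
  ones-≥1 n k = ℚₚ.+-mono-≤ (ℚₚ.≤-refl {1ℚ}) (ones-nonNeg n k)

  ℝ-char-0 : ∀ n → ¬ ones (suc n) ≋ 0#
  ℝ-char-0 n = ≥1⇒≉0 (ones (suc n)) (ones-≥1 n)

-- The ring operations of ℝ unfold to sequences with their moduli; stating
-- these facts through the projections of ℝ-commutativeRing keeps the
-- conversion checker from comparing such sequences.
module _ where
  open LinearAlgebra ℝ-commutativeRing using (Unit; _≋_; _⊕_; 1#)

  abstract
    #0⇒unit : ∀ x → x # 0ℝ → Unit x
    #0⇒unit x x#0 = restate (#0⇒invertible {x} x#0)
      where
      restate : (∃ λ y → x * y ≈ 1ℝ) → Unit x
      restate (y , eq) = y , eq

    half : ∃ λ h → h ⊕ h ≋ 1#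
    half = restate (fromℚ ½) λ _ → refl
      where
      restate : ∀ h → (∀ n → seq h n ℚ.+ seq h n ≡ 1ℚ) → ∃ λ h → h ⊕ h ≋ 1#
      restate h h+h≡1 = h , ≡⇒≈ {h + h} {1ℝ} h+h≡1

A-joins : ∀ X → let open WeightedGraph X in ∀ {e u v} → Joins e u v → A X u v ≡ weight e
A-joins X {e} {u} {v} joins with WeightedGraph.adjacent? X u v
... | yes (f , f-joins) = cong (WeightedGraph.weight X) (WeightedGraph.simple X f-joins joins)
... | no ¬adjacent      = contradiction (e , joins) ¬adjacent

A-nonadjacent : ∀ X {u v} → ¬ WeightedGraph.Adjacent X u v → A X u v ≡ 0ℝ
A-nonadjacent X {u} {v} ¬adjacent with WeightedGraph.adjacent? X u v
... | yes adjacent = contradiction adjacent ¬adjacent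
... | no _         = refl

module SubdivisionMatrix (X : WeightedGraph) where
  open WeightedGraph X
  open Subdivision X using (halfEnds; ends-distinct)
  open Incidence ℝ-commutativeRing X weight
  module S = WeightedGraph (S X)

  l : Vertex → S.Vertex
  l v = v ↑ˡ size

  r : Edge → S.Vertex
  r e = order ↑ʳ e

  -- Allowing both orders lets the blocks B and Bᵀ share a single computation of entries.
  Position : S.Vertex → S.Vertex → Vertex → Edge → Set
  Position x y v e = (x ≡ l v × y ≡ r e) ⊎ (x ≡ r e × y ≡ l v)

  HalfEdge : S.Vertex → S.Vertex → Set
  HalfEdge x y = ∃ λ v → ∃ λ e → (v ≡ proj₁ (ends e) ⊎ v ≡ proj₂ (ends e)) × Position x y v e

  half-joins : ∀ s {x y} → halfEnds s ≡ (x , y) ⊎ halfEnds s ≡ (y , x) → HalfEdge x y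
  half-joins (inj₁ e) (inj₁ refl) = _ , e , inj₁ refl , inj₁ (refl , refl)
  half-joins (inj₁ e) (inj₂ refl) = _ , e , inj₁ refl , inj₂ (refl , refl)
  half-joins (inj₂ e) (inj₁ refl) = _ , e , inj₂ refl , inj₂ (refl , refl)
  half-joins (inj₂ e) (inj₂ refl) = _ , e , inj₂ refl , inj₁ (refl , refl)

  adjacent⇒halfEdge : ∀ {x y} → S.Adjacent x y → HalfEdge x y
  adjacent⇒halfEdge (s , joins) = half-joins (splitAt size s) joins

  ¬halfEdge-ll : ∀ {u v} → ¬ HalfEdge (l u) (l v)
  ¬halfEdge-ll (_ , _ , _ , inj₁ (_ , eq)) = ↑ˡ≢↑ʳ _ _ eq
  ¬halfEdge-ll (_ , _ , _ , inj₂ (eq , _)) = ↑ˡ≢↑ʳ _ _ eq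

  ¬halfEdge-rr : ∀ {e f} → ¬ HalfEdge (r e) (r f)
  ¬halfEdge-rr (_ , _ , _ , inj₁ (eq , _)) = ↑ˡ≢↑ʳ _ _ (sym eq)
  ¬halfEdge-rr (_ , _ , _ , inj₂ (_ , eq)) = ↑ˡ≢↑ʳ _ _ (sym eq)

  A-ll : ∀ u v → A (S X) (l u) (l v) ≡ 0ℝ
  A-ll u v = A-nonadjacent (S X) (¬halfEdge-ll {u} {v} ∘ adjacent⇒halfEdge)

  A-rr : ∀ e f → A (S X) (r e) (r f) ≡ 0ℝ
  A-rr e f = A-nonadjacent (S X) (¬halfEdge-rr {e} {f} ∘ adjacent⇒halfEdge)

  subEnds-↑ˡ : ∀ e → S.ends (e ↑ˡ size) ≡ (l (proj₁ (ends e)) , r e)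
  subEnds-↑ˡ e = cong halfEnds (splitAt-↑ˡ size e size)

  subEnds-↑ʳ : ∀ e → S.ends (size ↑ʳ e) ≡ (r e , l (proj₂ (ends e)))
  subEnds-↑ʳ e = cong halfEnds (splitAt-↑ʳ size size e)

  subWeight-↑ˡ : ∀ e → S.weight (e ↑ˡ size) ≡ weight e
  subWeight-↑ˡ e rewrite splitAt-↑ˡ size e size = refl

  subWeight-↑ʳ : ∀ e → S.weight (size ↑ʳ e) ≡ weight e
  subWeight-↑ʳ e rewrite splitAt-↑ʳ size size e = refl

  source-joins : ∀ {x y v e} → Position x y v e → v ≡ proj₁ (ends e) → S.Joins (e ↑ˡ size) x y
  source-joins {e = e} (inj₁ (refl , refl)) refl = inj₁ (subEnds-↑ˡ e)
  source-joins {e = e} (inj₂ (refl , refl)) refl = inj₂ (subEnds-↑ˡ e)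

  target-joins : ∀ {x y v e} → Position x y v e → v ≡ proj₂ (ends e) → S.Joins (size ↑ʳ e) x y
  target-joins {e = e} (inj₁ (refl , refl)) refl = inj₂ (subEnds-↑ʳ e)
  target-joins {e = e} (inj₂ (refl , refl)) refl = inj₁ (subEnds-↑ʳ e)

  position-unique : ∀ {x y v w e f} → Position x y v e → Position x y w f → v ≡ w × e ≡ f
  position-unique (inj₁ (refl , refl)) (inj₁ (p , q)) = ↑ˡ-injective size _ _ p , ↑ʳ-injective order _ _ q
  position-unique (inj₁ (refl , refl)) (inj₂ (p , _)) = contradiction p (↑ˡ≢↑ʳ _ _)
  position-unique (inj₂ (refl , refl)) (inj₁ (p , _)) = contradiction (sym p) (↑ˡ≢↑ʳ _ _)
  position-unique (inj₂ (refl , refl)) (inj₂ (p , q)) = ↑ˡ-injective size _ _ q , ↑ʳ-injective order _ _ p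

  nonadjacent : ∀ {x y v e} → Position x y v e →
    v ≢ proj₁ (ends e) → v ≢ proj₂ (ends e) → ¬ S.Adjacent x y
  nonadjacent xy v≢x v≢y adjacent
    with w , f , end , position ← adjacent⇒halfEdge adjacent
    with position-unique xy position | end
  ... | refl , refl | inj₁ v≡x = v≢x v≡x
  ... | refl , refl | inj₂ v≡y = v≢y v≡y

  -- The cases are whether `v` is the first end of `e`, the second, or neither; looplessness rules
  -- out both.
  A≈B : ∀ {x y} v e → Position x y v e → A (S X) x y ≈ B v e
  A≈B {x} {y} v e xy = by-cases (v ≟ proj₁ (ends e)) (v ≟ proj₂ (ends e))
    where
    by-cases : Dec (v ≡ proj₁ (ends e)) → Dec (v ≡ proj₂ (ends e)) → A (S X) x y ≈ B v e
    by-cases (yes p) (yes q) = contradiction (trans (sym p) q) (ends-distinct {e})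
    by-cases (yes p) (no ¬q) = subst (_≈ B v e)
      (sym (trans (A-joins (S X) {e ↑ˡ size} (source-joins xy p)) (subWeight-↑ˡ e)))
      (≈-sym (B-source p ¬q))
    by-cases (no ¬p) (yes q) = subst (_≈ B v e)
      (sym (trans (A-joins (S X) {size ↑ʳ e} (target-joins xy q)) (subWeight-↑ʳ e)))
      (≈-sym (B-target ¬p q))
    by-cases (no ¬p) (no ¬q) = subst (_≈ B v e)
      (sym (A-nonadjacent (S X) (nonadjacent xy ¬p ¬q))) (≈-sym (B-other ¬p ¬q))

  open Blocks B (A (S X)) (λ u v → reflexive (A-ll u v)) (λ e f → reflexive (A-rr e f))
    (λ v e → A≈B v e (inj₁ (refl , refl))) (λ v e → A≈B v e (inj₂ (refl , refl)))

  nonsingular⇒inverse : Nonsingular (S X) → RectangularInverse B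
  nonsingular⇒inverse (M , AM , MA) = blocks⇒inverse M AM MA

  inverse⇒nonsingular : RectangularInverse B → Nonsingular (S X)
  inverse⇒nonsingular inverse = N inverse , MN inverse , NM inverse

  nonsingular⇒square : Nonsingular (S X) → order ≡ size
  nonsingular⇒square nonsingular = ones-injective ℝ-char-0 (trace-ones (nonsingular⇒inverse nonsingular))

  nonsingular⇒nonbipartite : Nonsingular (S X) → Vertex → ¬ Bipartite X
  nonsingular⇒nonbipartite nonsingular v = inverse⇒nonbipartite ℝ-char-0 (nonsingular⇒inverse nonsingular) v

  oddChord⇒nonsingular : (T : SpanningTree X) → Chords.OddChord T → Nonsingular (S X)
  oddChord⇒nonsingular T odd = inverse⇒nonsingular (Sufficiency.inverse T odd
    (λ e → #0⇒unit (weight e) (weight#0 e)) (proj₁ half) (proj₂ half))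

-- The equivalence

square∧nonbipartite⇒odd : ∀ {X} (T : SpanningTree X) → WeightedGraph.order X ≡ WeightedGraph.size X →
  ¬ Bipartite X → Chords.OddChord T
square∧nonbipartite⇒odd T square nonbipartite =
  oddChord nonbipartite (square⇒one-chord square)
  where open Chords T

-- A cycle has equally many vertices and edges by construction, whence `refl`, so only
-- nonbipartiteness remains to be supplied.
nonbipartite⇒cycle-nonsingular : ∀ {X} (C : Cycle X) → ¬ Bipartite (cycleGraph C) →
  Nonsingular (S (cycleGraph C))
nonbipartite⇒cycle-nonsingular C nonbipartite =
  SubdivisionMatrix.oddChord⇒nonsingular (cycleGraph C) T (square∧nonbipartite⇒odd T refl nonbipartite)
  where
  T : SpanningTree (cycleGraph C)
  T = spanningTree (cycleGraph C) (CycleParity.cycleGraph-connected C) zero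

odd⇒unicyclic∧cycle-nonsingular : ∀ {X} (T : SpanningTree X) → Chords.OddChord T → Connected X →
  Σ (Unicyclic X) λ u → Nonsingular (S (cycleGraph (Unicyclic.cycle u)))
odd⇒unicyclic∧cycle-nonsingular {X} T odd connected =
  U , nonbipartite⇒cycle-nonsingular (Unicyclic.cycle U) (cycleGraph-nonbipartite (Unicyclic.cycle U))
  where
  open Chords.OddChord odd
  U : Unicyclic X
  U = unicyclic connected

-- A 2-colouring of the graph would restrict to the cycle, where nonsingularity excludes it.
cycle-nonsingular⇒nonbipartite : ∀ {X} (C : Cycle X) → Nonsingular (S (cycleGraph C)) → ¬ Bipartite X
cycle-nonsingular⇒nonbipartite C nonsingular =
  SubdivisionMatrix.nonsingular⇒nonbipartite (cycleGraph C) nonsingular zero ∘ CycleParity.bipartite-cycleGraph C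

theorem34 : (X : WeightedGraph) → Connected X →
    Nonsingular (S X) ⇔ Σ (Unicyclic X) (λ u → Nonsingular (S (cycleGraph (Unicyclic.cycle u))))
theorem34 X connected = mk⇔ necessary sufficient
  where
  open WeightedGraph X
  open SubdivisionMatrix

  necessary : Nonsingular (S X) → Σ (Unicyclic X) λ u → Nonsingular (S (cycleGraph (Unicyclic.cycle u)))
  necessary nonsingular = odd⇒unicyclic∧cycle-nonsingular T
    (square∧nonbipartite⇒odd T square (nonsingular⇒nonbipartite X nonsingular v)) connected
    where
    square : order ≡ size
    square = nonsingular⇒square X nonsingular
    v : Vertex
    v = fromℕ< (ℕ.>-nonZero⁻¹ order {{proj₁ connected}})
    T : SpanningTree X
    -- The construction of the tree starts from an edge; there are as many edges as vertices, so the
    -- index of a vertex yields one.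
    T = spanningTree X connected (subst Fin square v)

  sufficient : Σ (Unicyclic X) (λ u → Nonsingular (S (cycleGraph (Unicyclic.cycle u)))) → Nonsingular (S X)
  sufficient (U , nonsingular) = oddChord⇒nonsingular X T
    (oddChord (cycle-nonsingular⇒nonbipartite (Unicyclic.cycle U) nonsingular) (unicyclic⇒one-chord U))
    where
    T : SpanningTree X
    T = spanningTree X connected (Cycle.edge (Unicyclic.cycle U) zero)
    open Chords T
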